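{- Let $\phi$ be an odd set composition of $[n]$ and $\psi$ a set composition with $\psi\le\phi$. Then $$\sum_{\chi\in\mathscr D_\phi^\psi}2^{\ell(\psi\wedge\chi)-\ell(\chi)}\mu_{\ell(\chi)}=2^{\ell(\psi)-1}.$$
   Context: $[n]=\{1,\dots,n\}$. A set composition $\phi=\phi_1|\cdots|\phi_{\ell(\phi)}$ of $[n]$ is a sequence of pairwise disjoint nonempty sets with union $[n]$; it is odd if every block has odd size. For set compositions, $\psi\le\phi$ means each block of $\psi$ is a union of consecutive blocks of $\phi$. $\psi\wedge\chi$ is the set composition obtained from $\psi_1\cap\chi_1,\psi_1\cap\chi_2,\dots,\psi_1\cap\chi_{\ell(\chi)},\psi_2\cap\chi_1,\dots,\psi_{\ell(\psi)}\cap\chi_{\ell(\chi)}$ by deleting empty sets. $\mathscr C_\phi^\psi=\{\phi_{\tau(1)}|\cdots|\phi_{\tau(\ell(\phi))}:\tau\in\mathfrak S_{\ell(\phi)},\ \psi\wedge(\phi_{\tau(1)}|\cdots|\phi_{\tau(\ell(\phi))})=\phi\}$, and $\mathscr D_\phi^\psi=\{\chi:\chi\text{ an odd set composition of }[n],\ \chi\le\xi\text{ for some }\xi\in\mathscr C_\phi^\psi\}$. For a positive integer $\ell$, consider the poset of odd compositions of $\ell$ (sequences of odd positive integers summing to $\ell$), ordered by $\beta\le\alpha$ if each part of $\beta$ is a sum of consecutive parts of $\alpha$, with Möbius function $\mu$; set $\mu_\ell=\sum_{\beta}\mu(\beta,(1,1,\dots,1))$, summed over all odd compositions $\beta$ of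 $\ell$. -}

module Defs where

open import Data.Nat as ℕ using (ℕ; zero; suc; _∸_; _%_)
open import Data.Nat.Properties as ℕP using ()
open import Data.Integer as ℤ using (ℤ; +_; -_)
open import Data.List using (List; []; _∷_; [_]; map; concat; concatMap; filter; length; upTo; foldr; tabulate; lookup; replicate)
open import Data.Nat.ListAction using (sum)
open import Data.List.Properties using (≡-dec)
open import Data.List.Relation.Unary.All using (All)
open import Data.List.Relation.Unary.Any using (Any; any?)
open import Data.List.Relation.Unary.AllPairs using (AllPairs)
open import Data.Fin using (Fin)
open import Data.Fin.Subset using (Subset; _∩_; _∈_; ⋃; ∣_∣; Nonempty; Empty)
open import Data.Fin.Subset.Properties using (nonempty?)
open import Data.Fin.Permutation using (Permutation′; _⟨$⟩ʳ_)
open import Data.Product using (Σ; ∃; _×_; _,_)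
open import Relation.Binary.PropositionalEquality using (_≡_; _≢_)
open import Relation.Nullary using (Dec; yes; no; ¬?)
open import Relation.Nullary.Decidable using (_×-dec_)

sumℤ : List ℤ → ℤ
sumℤ = foldr ℤ._+_ (+ 0)

IsOdd : ℕ → Set
IsOdd k = k % 2 ≡ 1

isOdd? : (k : ℕ) → Dec (IsOdd k)
isOdd? k = (k % 2) ℕ.≟ 1

IsSplit : {A : Set} → List A → List (List A) → Set
IsSplit xs gs = All (λ g → g ≢ []) gs × concat gs ≡ xs

private
  extend : {A : Set} → A → List (List A) → List (List (List A))
  extend x []       = [ [ x ] ] ∷ []
  extend x (g ∷ gs) = ((x ∷ g) ∷ gs) ∷ ([ x ] ∷ g ∷ gs) ∷ []

allSplits : {A : Set} → List A → List (List (List A))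
allSplits []       = [] ∷ []
allSplits (x ∷ xs) = concatMap (extend x) (allSplits xs)

SetComp : ℕ → Set
SetComp n = List (Subset n)

IsSetComp : {n : ℕ} → SetComp n → Set
IsSetComp {n} φ =
  All Nonempty φ × AllPairs (λ A B → Empty (A ∩ B)) φ × ((x : Fin n) → Any (x ∈_) φ)

IsOddSC : {n : ℕ} → SetComp n → Set
IsOddSC φ = All (λ b → IsOdd ∣ b ∣) φ

_≤SC_ : {n : ℕ} → SetComp n → SetComp n → Set
ψ ≤SC φ = ∃ λ gs → IsSplit φ gs × map ⋃ gs ≡ ψ

_∧SC_ : {n : ℕ} → SetComp n → SetComp n → SetComp n
ψ ∧SC χ = filter nonempty? (concatMap (λ a → map (a ∩_) χ) ψ)

rearrange : {n : ℕ} (φ : SetComp n) → Permutation′ (length φ) → SetComp n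
rearrange φ τ = tabulate (λ i → lookup φ (τ ⟨$⟩ʳ i))

InC : {n : ℕ} → SetComp n → SetComp n → SetComp n → Set
InC φ ψ ξ = ∃ λ (τ : Permutation′ (length φ)) → ξ ≡ rearrange φ τ × (ψ ∧SC ξ) ≡ φ

InD : {n : ℕ} → SetComp n → SetComp n → SetComp n → Set
InD φ ψ χ = IsSetComp χ × IsOddSC χ × ∃ λ ξ → InC φ ψ ξ × χ ≤SC ξ

-- compositions of n (fuel-bounded; fuel n suffices)
private
  compsF : ℕ → ℕ → List (List ℕ)
  compsF _        zero    = [] ∷ []
  compsF zero     (suc n) = []
  compsF (suc f)  (suc n) =
    concatMap (λ k → map (suc k ∷_) (compsF f (n ∸ k))) (upTo (suc n))

compositions : ℕ → List (List ℕ)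
compositions n = compsF n n

oddCompositions : ℕ → List (List ℕ)
oddCompositions ℓ = filter (λ α → Data.List.Relation.Unary.All.all? isOdd? α) (compositions ℓ)

_≤C_ : List ℕ → List ℕ → Set
β ≤C α = Any (λ gs → map sum gs ≡ β) (allSplits α)

_≤C?_ : (β α : List ℕ) → Dec (β ≤C α)
β ≤C? α = any? (λ gs → ≡-dec ℕ._≟_ (map sum gs) β) (allSplits α)

-- Möbius function of a finite poset P (given as a duplicate-free list with
-- the order _≤C_), via  μ(x,x) = 1,  μ(x,y) = - Σ_{x ≤ z < y} μ(x,z)  (x < y),
-- μ(x,y) = 0 otherwise.  The fuel (length P) bounds chain lengths.
mobF : List (List ℕ) → ℕ → List ℕ → List ℕ → ℤ
mobF P zero    x y = + 0
mobF P (suc f) x y with ≡-dec ℕ._≟_ x y | x ≤C? y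
... | yes _ | _     = + 1
... | no _  | yes _ = - sumℤ (map (mobF P f x)
                         (filter (λ z → (x ≤C? z) ×-dec ((z ≤C? y) ×-dec ¬? (≡-dec ℕ._≟_ z y))) P))
... | no _  | no _  = + 0

mobOdd : (ℓ : ℕ) → List ℕ → List ℕ → ℤ
mobOdd ℓ = mobF (oddCompositions ℓ) (length (oddCompositions ℓ))

μ : ℕ → ℤ
μ ℓ = sumℤ (map (λ β → mobOdd ℓ β (replicate ℓ 1)) (oddCompositions ℓ))

{-# OPTIONS --safe #-}
-- Every block of φ has odd size, so a member χ of D_φ^ψ amounts to a sequence of tuples, one for each
-- block of χ, which cuts an odd number of blocks of φ off the fronts of the words φ|ψ₁, …, φ|ψ_k.
-- With x_i marking the blocks of φ|ψ_i, put E = Π (1+x_i)/(1-x_i) = Σ_v 2^|supp v| x^v; the left-hand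
-- side is a coefficient of M(F), where M = Σ_ℓ μ_ℓ x^ℓ (with μ_0 = 1) and F = (E - 1/E)/4 is the odd
-- part of Q = (E+1)/2 = Σ_v 2^(|supp v| ∸ 1) x^v.
-- Summing the Möbius recursion over the lower set of a composition shows that the sum of μ_ℓ(β) over
-- all odd compositions β of L is 1, that is, M(u/(1-u²)) = 1/(1-u).  For u = (Q-1)/Q we have
-- F = u/(1-u²) and 1/(1-u) = Q, so M(F) = Q.
module Submission where

open import Defs
open import Algebra.Bundles using (CommutativeMonoid; CommutativeSemiring)
open import Algebra.Structures.Biased using (isCommutativeSemiringˡ)
open import Data.Bool using (Bool; T; true; false; if_then_else_; not; _∧_)
open import Data.Fin as Fin using (Fin)
open import Data.Fin.Permutation using (Permutation; Permutation′; _⟨$⟩ʳ_)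
open import Data.Fin.Subset using (Subset; inside; outside; _∩_; _∪_; ⋃; ∣_∣; Nonempty; Empty) renaming (_∈_ to _∈ₛ_; _⊆_ to _⊆ₛ_)
open import Data.Fin.Subset.Properties using (nonempty?; x∈p∩q⁺; x∈p∩q⁻; x∈p∪q⁺; x∈p∪q⁻; ∉⊥; ∣⊥∣≡0; ⊆-antisym)
open import Data.Integer as ℤ using (ℤ; +_; -_; _+_; _*_; _-_; 0ℤ; 1ℤ)
import Data.Integer.Properties as ℤ
open import Data.Integer.Tactic.RingSolver using (solve-∀)
open import Data.List using (List; []; _∷_; [_]; _++_; map; concat; concatMap; filter; length; upTo; replicate; lookup; tabulate)
open import Data.List.Membership.Propositional using (_∈_; find; lose)
open import Data.List.Membership.Propositional.Properties using (∈-map⁺; ∈-map⁻; ∈-concatMap⁺; ∈-concatMap⁻; ∈-filter⁺; ∈-filter⁻; ∈-++⁺ˡ; ∈-++⁺ʳ; ∈-++⁻; ∈-upTo⁺; ∈-upTo⁻; ∈-concat⁺′; ∈-concat⁻′; ∈-lookup; ∈-tabulate⁻)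
open import Data.List.Membership.Propositional.Properties.WithK using (unique∧set⇒bag)
open import Data.List.Properties using (map-∘; map-id; map-cong; map-cong-local; ∷-injective; ∷-injectiveˡ; ∷-injectiveʳ; length-map; length-replicate; length-++; ++-cancelˡ; ++-identityʳ; concat-concat; ≡-dec; filter-≐; filter-notAll; filter-all; filter-none; filter-++; filter-accept; filter-reject; tabulate-lookup; tabulate-cong)
open import Data.List.Relation.Binary.BagAndSetEquality using (∼bag⇒↭)
open import Data.List.Relation.Binary.Permutation.Homogeneous using (onIndices)
open import Data.List.Relation.Binary.Permutation.Propositional as ↭ using (_↭_; prep; swap; ↭-sym; ↭-trans; ↭-refl; ↭-reflexive; ↭⇒↭ₛ)
import Data.List.Relation.Binary.Permutation.Propositional.Properties as ↭
import Data.List.Relation.Binary.Permutation.Setoid.Properties as ↭ₛ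
open import Data.List.Relation.Binary.Pointwise as Pointwise using (Pointwise; []; _∷_)
open import Data.List.Relation.Unary.All as All using (All; []; _∷_)
import Data.List.Relation.Unary.All.Properties as All
open import Data.List.Relation.Unary.AllPairs using (AllPairs; []; _∷_)
open import Data.List.Relation.Unary.Any using (Any; here; there)
open import Data.List.Relation.Unary.Unique.Propositional using (Unique)
import Data.List.Relation.Unary.Unique.Propositional.Properties as Unique
open import Data.Nat as ℕ using (ℕ; zero; suc; z≤n; s≤s; _∸_; _≤_; _<_; _^_)
open import Data.Nat.Induction using (<-rec)
open import Data.Nat.ListAction using (sum)
open import Data.Nat.ListAction.Properties using (sum-++)
import Data.Nat.Properties as ℕ
open import Data.Nat.Properties using (module ≤-Reasoning)
open import Data.Product using (∃; _×_; _,_; proj₁; proj₂)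
open import Data.Sum using (inj₁; inj₂)
open import Data.Unit using (tt)
open import Data.Vec as Vec using ()
open import Function using (_∘_; case_of_)
open import Function.Bundles using (_⇔_; mk⇔; Equivalence)
open import Relation.Binary.Bundles using (Setoid)
open import Relation.Binary.PropositionalEquality hiding ([_])
import Relation.Binary.Reasoning.Setoid as SetoidReasoning
open import Relation.Binary.Structures using (IsEquivalence)
open import Relation.Nullary using (Dec; does; yes; no; ¬_; ¬?; contradiction)
open import Relation.Nullary.Decidable using (_×-dec_; dec-true; dec-false)
open import Relation.Unary using (Decidable)
open import Algebra.Properties.AbelianGroup ℤ.+-0-abelianGroup using (∙-cancelˡ; ∙-cancelʳ)
open import Algebra.Properties.CommutativeSemigroup ℤ.+-commutativeSemigroup using (interchange; x∙yz≈y∙xz)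
open import Algebra.Properties.CommutativeSemigroup ℕ.+-commutativeSemigroup using () renaming (interchange to ℕ-interchange; x∙yz≈y∙xz to ℕ-x∙yz≈y∙xz)

-- The identity for M needs a fact that the overview passes over: the sum of μ(β,γ) over all β
-- depends on γ only through its length. All parts being odd, a sum of parts is odd exactly if their
-- number is, so the lower set of γ looks like the splits of ℓ(γ) items into odd groups, and
-- induction on the length applies. The coefficient of u^j in (u/(1-u²))^ℓ counts the splits of j
-- items into ℓ odd groups; this is where u/(1-u²) comes from. The exponent ℓ(ψ∧χ)-ℓ(χ) splits over
-- the blocks of χ: a block with tuple of lengths v meets |supp v| blocks of ψ and contributes
-- 2^(|supp v|-1), a coefficient of Q. Oddness of χ restricts Q to F. The choice of u is forced:
-- M(u/(1-u²)) = 1/(1-u) is to become M(F) = Q, so 1/(1-u) = Q. The formal obstacle is that u is a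
-- quotient and M is infinite. Neither is formed: denominators are cleared by powers of Q, and
-- equalities hold below a degree n. As P and F have no constant term, each factor P or F gains one
-- degree, which drives the inductions on n.

private variable
  A B : Set
  n : ℕ

-- Finite sums of integers and lists without repetition

+-congˡ : ∀ a {b c} → b ≡ c → a + b ≡ a + c
+-congˡ a = cong (λ t → a + t)

∑ : List A → (A → ℤ) → ℤ
∑ xs f = sumℤ (map f xs)

∑-cong : {f g : A → ℤ} (xs : List A) → (∀ {x} → x ∈ xs → f x ≡ g x) → ∑ xs f ≡ ∑ xs g
∑-cong []       eq = refl
∑-cong (x ∷ xs) eq = cong₂ _+_ (eq (here refl)) (∑-cong xs (eq ∘ there))

∑-zero : {f : A → ℤ} (xs : List A) → (∀ {x} → x ∈ xs → f x ≡ 0ℤ) → ∑ xs f ≡ 0ℤ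
∑-zero []       eq = refl
∑-zero (x ∷ xs) eq = cong₂ _+_ (eq (here refl)) (∑-zero xs (eq ∘ there))

∑-++ : (xs ys : List A) {f : A → ℤ} → ∑ (xs ++ ys) f ≡ ∑ xs f + ∑ ys f
∑-++ []       ys     = sym (ℤ.+-identityˡ _)
∑-++ (x ∷ xs) ys {f} = trans (+-congˡ (f x) (∑-++ xs ys)) (sym (ℤ.+-assoc (f x) _ _))

∑-concatMap : (h : A → List B) (xs : List A) {f : B → ℤ} →
  ∑ (concatMap h xs) f ≡ ∑ xs (λ x → ∑ (h x) f)
∑-concatMap h []           = refl
∑-concatMap h (x ∷ xs) {f} = trans (∑-++ (h x) _) (+-congˡ (∑ (h x) f) (∑-concatMap h xs))

∑-map : (h : A → B) (xs : List A) {f : B → ℤ} → ∑ (map h xs) f ≡ ∑ xs (f ∘ h)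
∑-map h xs = cong sumℤ (sym (map-∘ xs))

∑-+ : (xs : List A) (f g : A → ℤ) → ∑ xs (λ x → f x + g x) ≡ ∑ xs f + ∑ xs g
∑-+ []       f g = refl
∑-+ (x ∷ xs) f g = trans (+-congˡ (f x + g x) (∑-+ xs f g)) (interchange (f x) (g x) _ _)

∑-*ˡ : (c : ℤ) (xs : List A) (f : A → ℤ) → ∑ xs (λ x → c * f x) ≡ c * ∑ xs f
∑-*ˡ c []       f = sym (ℤ.*-zeroʳ c)
∑-*ˡ c (x ∷ xs) f = trans (+-congˡ (c * f x) (∑-*ˡ c xs f)) (sym (ℤ.*-distribˡ-+ c (f x) _))

∑-swap : (xs : List A) (ys : List B) (f : A → B → ℤ) →
  ∑ xs (λ x → ∑ ys (f x)) ≡ ∑ ys (λ y → ∑ xs (λ x → f x y))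
∑-swap []       ys f = sym (∑-zero ys (λ _ → refl))
∑-swap (x ∷ xs) ys f = trans (+-congˡ (∑ ys (f x)) (∑-swap xs ys f)) (sym (∑-+ ys (f x) _))

∑-filter : {P : A → Set} (P? : Decidable P) (xs : List A) {f : A → ℤ} →
  ∑ (filter P? xs) f ≡ ∑ xs (λ x → if does (P? x) then f x else 0ℤ)
∑-filter P? []           = refl
∑-filter P? (x ∷ xs) {f} with does (P? x)
... | true  = +-congˡ (f x) (∑-filter P? xs)
... | false = trans (∑-filter P? xs) (sym (ℤ.+-identityˡ _))

∑-↭ : {xs ys : List A} (f : A → ℤ) → xs ↭ ys → ∑ xs f ≡ ∑ ys f
∑-↭ f ↭.refl          = refl
∑-↭ f (prep x p)      = +-congˡ (f x) (∑-↭ f p)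
∑-↭ f (swap {xs} {ys} x y p) = begin
  f x + (f y + ∑ xs f)  ≡⟨ ℤ.+-assoc (f x) _ _ ⟨
  (f x + f y) + ∑ xs f  ≡⟨ cong₂ _+_ (ℤ.+-comm (f x) (f y)) (∑-↭ f p) ⟩
  (f y + f x) + ∑ ys f  ≡⟨ ℤ.+-assoc (f y) _ _ ⟩
  f y + (f x + ∑ ys f)  ∎
  where open ≡-Reasoning
∑-↭ f (↭.trans p q)   = trans (∑-↭ f p) (∑-↭ f q)

∑-set : {xs ys : List A} (f : A → ℤ) → Unique xs → Unique ys →
  (∀ {x} → x ∈ xs → x ∈ ys) → (∀ {x} → x ∈ ys → x ∈ xs) → ∑ xs f ≡ ∑ ys f
∑-set f u v xs⊆ys ys⊆xs = ∑-↭ f (∼bag⇒↭ (unique∧set⇒bag u v (mk⇔ xs⊆ys ys⊆xs)))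

∑-single : {xs : List A} {x : A} (f : A → ℤ) → Unique xs → x ∈ xs →
  (∀ {y} → y ∈ xs → y ≢ x → f y ≡ 0ℤ) → ∑ xs f ≡ f x
∑-single f (x∉ ∷ u) (here refl) f≡0 =
  trans (+-congˡ (f _) (∑-zero _ (λ y∈ → f≡0 (there y∈) (λ { refl → All.lookup x∉ y∈ refl })))) (ℤ.+-identityʳ _)
∑-single f (x∉ ∷ u) (there x∈) f≡0 =
  trans (cong₂ _+_ (f≡0 (here refl) (All.lookup x∉ x∈)) (∑-single f u x∈ (f≡0 ∘ there))) (ℤ.+-identityˡ _)

map-unique : {f : A → B} {xs : List A} → (∀ {x y} → x ∈ xs → y ∈ xs → f x ≡ f y → x ≡ y) →
  Unique xs → Unique (map f xs)
map-unique inj []       = []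
map-unique {f = f} inj (x∉ ∷ u) =
  All.tabulate (λ z∈ fx≡z → let y , y∈ , z≡fy = ∈-map⁻ f z∈ in
    All.lookup x∉ y∈ (inj (here refl) (there y∈) (trans fx≡z z≡fy)))
  ∷ map-unique (λ x∈ y∈ → inj (there x∈) (there y∈)) u

concatMap-unique : {h : A → List B} {xs : List A} → Unique xs →
  (∀ {x} → x ∈ xs → Unique (h x)) →
  (∀ {x y z} → x ∈ xs → y ∈ xs → z ∈ h x → z ∈ h y → x ≡ y) →
  Unique (concatMap h xs)
concatMap-unique []       uh disj = []
concatMap-unique {h = h} {x ∷ xs} (x∉ ∷ u) uh disj =
  Unique.++⁺ (uh (here refl)) (concatMap-unique u (uh ∘ there) (λ x∈ y∈ → disj (there x∈) (there y∈)))
    (λ (z∈hx , z∈) → let y , y∈ , z∈hy = find (∈-concatMap⁻ h z∈) in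
      All.lookup x∉ y∈ (disj (here refl) (there y∈) z∈hx z∈hy))

-- Odd compositions and their order

compositions-step : ∃ λ (tails : ℕ → ℕ → List (List ℕ)) →
  ∀ n → compositions (suc n) ≡ concatMap (λ k → map (suc k ∷_) (tails n k)) (upTo (suc n))
compositions-step = _ , λ n → refl

-- The fuelled enumerations inside compositions and allSplits are private in Defs;
-- unification recovers them from the unfolded definitions.
mutual
  fuelledCompositions : ℕ → ℕ → List (List ℕ)
  fuelledCompositions = _

  compositions-tails : ∀ n k → proj₁ compositions-step n k ≡ fuelledCompositions n (n ∸ k)
  -- Once `n ∸ k` is a variable, the unknown enumeration is applied to two distinct variables and
  -- unification determines it.
  compositions-tails n k with n ∸ k
  ... | m = refl

mutual
  extend : A → List (List A) → List (List (List A))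
  extend = _

  allSplits-∷ : (x : A) (xs : List A) → allSplits (x ∷ xs) ≡ concatMap (extend x) (allSplits xs)
  allSplits-∷ x xs = refl

fuelledCompositions-sum : ∀ f n {α} → α ∈ fuelledCompositions f n → sum α ≡ n
fuelledCompositions-sum f       zero    (here refl) = refl
fuelledCompositions-sum (suc f) (suc n) α∈
  with k , k∈ , α∈′ ← find (∈-concatMap⁻ (λ k → map (suc k ∷_) (fuelledCompositions f (n ∸ k))) {upTo (suc n)} α∈)
  with α′ , α′∈ , refl ← ∈-map⁻ (suc k ∷_) α∈′ =
  cong suc (trans (cong (k ℕ.+_) (fuelledCompositions-sum f (n ∸ k) α′∈))
                  (ℕ.m+[n∸m]≡n (ℕ.s≤s⁻¹ (∈-upTo⁻ k∈))))

fuelledCompositions-complete : ∀ f α → sum α ≤ f → All (0 <_) α → α ∈ fuelledCompositions f (sum α)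
fuelledCompositions-complete f       []          _         []        = here refl
fuelledCompositions-complete (suc f) (suc k ∷ α) (s≤s α≤f) (_ ∷ pos) =
  ∈-concatMap⁺ (λ k′ → map (suc k′ ∷_) (fuelledCompositions f (k ℕ.+ sum α ∸ k′)))
    (lose (∈-upTo⁺ (s≤s (ℕ.m≤m+n k (sum α))))
      (∈-map⁺ (suc k ∷_) (subst (λ m → α ∈ fuelledCompositions f m) (sym (ℕ.m+n∸m≡n k (sum α)))
        (fuelledCompositions-complete f α (ℕ.≤-trans (ℕ.m≤n+m (sum α) k) α≤f) pos))))

fuelledCompositions-unique : ∀ f n → Unique (fuelledCompositions f n)
fuelledCompositions-unique f       zero    = [] ∷ []
fuelledCompositions-unique zero    (suc n) = []
fuelledCompositions-unique (suc f) (suc n) =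
  concatMap-unique (Unique.upTo⁺ (suc n))
    (λ {k} _ → Unique.map⁺ ∷-injectiveʳ (fuelledCompositions-unique f (n ∸ k)))
    (λ {j} {k} _ _ α∈j α∈k →
      let _ , _ , α≡j = ∈-map⁻ (suc j ∷_) α∈j
          _ , _ , α≡k = ∈-map⁻ (suc k ∷_) α∈k
      in ℕ.suc-injective (∷-injectiveˡ (trans (sym α≡j) α≡k)))

odd⇒positive : ∀ k → IsOdd k → 0 < k
odd⇒positive (suc k) _ = s≤s z≤n

∈-oddCompositions⁺ : ∀ {α} → All IsOdd α → α ∈ oddCompositions (sum α)
∈-oddCompositions⁺ {α} odd = ∈-filter⁺ (λ α → All.all? isOdd? α)
  (fuelledCompositions-complete (sum α) α ℕ.≤-refl (All.map (odd⇒positive _) odd)) odd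

∈-oddCompositions⁻ : ∀ {L α} → α ∈ oddCompositions L → All IsOdd α × sum α ≡ L
∈-oddCompositions⁻ {L} α∈ with α∈′ , odd ← ∈-filter⁻ (λ α → All.all? isOdd? α) {xs = compositions L} α∈ =
  odd , fuelledCompositions-sum L L α∈′

oddCompositions-unique : ∀ L → Unique (oddCompositions L)
oddCompositions-unique L = Unique.filter⁺ (λ α → All.all? isOdd? α) (fuelledCompositions-unique L L)

∈-allSplits⁻ : (xs : List A) {gs : List (List A)} → gs ∈ allSplits xs → IsSplit xs gs
∈-allSplits⁻ []       (here refl) = [] , refl
∈-allSplits⁻ (x ∷ xs) gs∈ with find (∈-concatMap⁻ (extend x) {allSplits xs} gs∈)
... | []     , hs∈ , here refl with ∈-allSplits⁻ xs hs∈
...   | _ , refl = (λ ()) ∷ [] , refl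
∈-allSplits⁻ (x ∷ xs) gs∈ | h ∷ hs , hs∈ , here refl with ∈-allSplits⁻ xs hs∈
...   | _ ∷ ne , refl = (λ ()) ∷ ne , refl
∈-allSplits⁻ (x ∷ xs) gs∈ | h ∷ hs , hs∈ , there (here refl) with ∈-allSplits⁻ xs hs∈
...   | ne , refl = (λ ()) ∷ ne , refl

∈-allSplits⁺ : (xs : List A) {gs : List (List A)} → IsSplit xs gs → gs ∈ allSplits xs
∈-allSplits⁺ []       {[]}               _              = here refl
∈-allSplits⁺ []       {[] ∷ gs}          (ne ∷ _ , _)   = contradiction refl ne
∈-allSplits⁺ (x ∷ xs) {[] ∷ gs}          (ne ∷ _ , _)   = contradiction refl ne
∈-allSplits⁺ (x ∷ xs) {(_ ∷ []) ∷ []}    (_ ∷ _  , refl) = here refl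
∈-allSplits⁺ (x ∷ xs) {(_ ∷ []) ∷ g ∷ gs} (_ ∷ ne , refl) =
  ∈-concatMap⁺ (extend x) (lose (∈-allSplits⁺ xs (ne , refl)) (there (here refl)))
∈-allSplits⁺ (x ∷ xs) {(_ ∷ y ∷ g) ∷ gs} (_ ∷ ne , refl) =
  ∈-concatMap⁺ (extend x) (lose (∈-allSplits⁺ xs ((λ ()) ∷ ne , refl)) (here refl))

allSplits-unique : (xs : List A) → Unique (allSplits xs)
allSplits-unique []       = [] ∷ []
allSplits-unique {A} (x ∷ xs) = concatMap-unique (allSplits-unique xs) (λ {hs} _ → extend-unique hs)
  (λ g∈ h∈ z∈g z∈h → trans (sym (unextend-extend g∈ z∈g)) (unextend-extend h∈ z∈h))
  where
  extend-unique : ∀ hs → Unique (extend x hs)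
  extend-unique []       = [] ∷ []
  extend-unique (h ∷ hs) = ((λ eq → contradiction (cong length (∷-injectiveʳ eq)) (ℕ.<⇒≢ ℕ.≤-refl)) ∷ []) ∷ [] ∷ []

  -- A left inverse of `extend x`; with it, extensions of different splits of `xs` are different.
  unextend : List (List A) → List (List A)
  unextend ((_ ∷ y ∷ g) ∷ gs) = (y ∷ g) ∷ gs
  unextend (_ ∷ gs)           = gs
  unextend []                 = []

  unextend-extend : ∀ {hs gs} → hs ∈ allSplits xs → gs ∈ extend x hs → unextend gs ≡ hs
  unextend-extend {[]}           hs∈ (here refl) = refl
  unextend-extend {[] ∷ hs}      hs∈ gs∈         = contradiction refl (All.head (proj₁ (∈-allSplits⁻ xs hs∈)))
  unextend-extend {(_ ∷ _) ∷ hs} hs∈ (here refl) = refl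
  unextend-extend {(_ ∷ _) ∷ hs} hs∈ (there (here refl)) = refl

singletons-split : (xs : List A) → IsSplit xs (map [_] xs)
singletons-split []       = [] , refl
singletons-split (x ∷ xs) with ne , eq ← singletons-split xs = (λ ()) ∷ ne , cong (x ∷_) eq

length-split : {xs : List A} {gs : List (List A)} → IsSplit xs gs → length gs ≤ length xs
length-split {gs = []}               (_ , refl)      = z≤n
length-split {gs = [] ∷ gs}          (ne ∷ _ , refl) = contradiction refl ne
length-split {gs = (x ∷ g) ∷ gs}     (_ ∷ ne , refl) =
  s≤s (ℕ.≤-trans (length-split (ne , refl)) (ℕ.≤-trans (ℕ.m≤n+m _ (length g)) (ℕ.≤-reflexive (sym (length-++ g)))))

finest-split : {xs : List A} {gs : List (List A)} → IsSplit xs gs → length gs ≡ length xs → gs ≡ map [_] xs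
finest-split {gs = []}           (_ , refl)      eq = refl
finest-split {gs = [] ∷ gs}      (ne ∷ _ , refl) eq = contradiction refl ne
finest-split {gs = (x ∷ []) ∷ gs} (_ ∷ ne , refl) eq = cong ([ x ] ∷_) (finest-split (ne , refl) (ℕ.suc-injective eq))
finest-split {gs = (x ∷ y ∷ g) ∷ gs} (_ ∷ ne , refl) eq =
  contradiction (ℕ.suc-injective eq)
    (ℕ.<⇒≢ (s≤s (ℕ.≤-trans (length-split (ne , refl)) (ℕ.≤-trans (ℕ.m≤n+m _ (length g)) (ℕ.≤-reflexive (sym (length-++ g)))))))

sum-singletons : ∀ α → map sum (map [_] α) ≡ α
sum-singletons α = trans (sym (map-∘ α)) (trans (map-cong ℕ.+-identityʳ α) (map-id α))

≤C⁺ : ∀ {β α gs} → IsSplit α gs → map sum gs ≡ β → β ≤C α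
≤C⁺ {α = α} split eq = lose (∈-allSplits⁺ α split) eq

≤C⁻ : ∀ {β α} → β ≤C α → ∃ λ gs → IsSplit α gs × map sum gs ≡ β
≤C⁻ {α = α} β≤α with gs , gs∈ , eq ← find β≤α = gs , ∈-allSplits⁻ α gs∈ , eq

≤C-refl : ∀ α → α ≤C α
≤C-refl α = ≤C⁺ (singletons-split α) (sum-singletons α)

unmap-++ : (f : A → B) (xs : List A) (h : List B) {k : List B} → map f xs ≡ h ++ k →
  ∃ λ ys → ∃ λ zs → xs ≡ ys ++ zs × map f ys ≡ h × map f zs ≡ k
unmap-++ f xs       []      eq = [] , xs , refl , refl , eq
unmap-++ f (x ∷ xs) (b ∷ h) eq with b≡ , eq′ ← ∷-injective eq
  with ys , zs , xs≡ , ys≡ , zs≡ ← unmap-++ f xs h eq′ =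
  x ∷ ys , zs , cong (x ∷_) xs≡ , cong₂ _∷_ b≡ ys≡ , zs≡

-- Needed for transitivity of `_≤C_`, where a split of the list of group sums has to be turned into
-- a split of the list of groups.
unmap-concat : (f : A → B) (xs : List A) (hs : List (List B)) → map f xs ≡ concat hs →
  ∃ λ yss → xs ≡ concat yss × map (map f) yss ≡ hs
unmap-concat f []       []       eq = [] , refl , refl
unmap-concat f xs       (h ∷ hs) eq
  with ys , zs , xs≡ , ys≡ , zs≡ ← unmap-++ f xs h eq
  with yss , zs≡′ , yss≡ ← unmap-concat f zs hs zs≡ =
  ys ∷ yss , trans xs≡ (cong (ys ++_) zs≡′) , cong₂ _∷_ ys≡ yss≡

sum-concat : ∀ αs → sum (concat αs) ≡ sum (map sum αs)
sum-concat []       = refl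
sum-concat (α ∷ αs) = trans (sum-++ α (concat αs)) (cong (sum α ℕ.+_) (sum-concat αs))

concat≢[] : {gs : List (List A)} → All (_≢ []) gs → gs ≢ [] → concat gs ≢ []
concat≢[] {gs = []}             _        ne = contradiction refl ne
concat≢[] {gs = [] ∷ _}         (ne ∷ _) _  = contradiction refl ne
concat≢[] {gs = (_ ∷ _) ∷ _}    _        _  = λ ()

≤C-trans : ∀ {γ β α} → γ ≤C β → β ≤C α → γ ≤C α
≤C-trans {γ} {β} {α} γ≤β β≤α
  with gs , (gs≢[] , gs≡) , refl ← ≤C⁻ {α = α} β≤α
  with hs , (hs≢[] , hs≡) , refl ← ≤C⁻ {α = map sum gs} γ≤β
  with ks , refl , refl ← unmap-concat sum gs hs (sym hs≡) =
  ≤C⁺ (concats≢[] ks gs≢[] hs≢[] , trans (concat-concat ks) gs≡)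
      (trans (sym (map-∘ ks)) (trans (map-cong sum-concat ks) (map-∘ ks)))
  where

  concats≢[] : ∀ ks → All (_≢ []) (concat ks) → All (_≢ []) (map (map sum) ks) → All (_≢ []) (map concat ks)
  concats≢[] []       _  _         = []
  concats≢[] (k ∷ ks) ne (ne′ ∷ nes) =
    concat≢[] (All.++⁻ˡ k ne) (λ { refl → ne′ refl }) ∷ concats≢[] ks (All.++⁻ʳ k ne) nes

≤C⇒length≤ : ∀ {β} α → β ≤C α → length β ≤ length α
≤C⇒length≤ α β≤α with gs , split , refl ← ≤C⁻ {α = α} β≤α =
  ℕ.≤-trans (ℕ.≤-reflexive (length-map sum gs)) (length-split split)

-- A split with as many groups as entries has only singletons. Length thus acts as a strictly
-- monotone rank, which yields antisymmetry and bounds the recursion of `mobF`.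
≤C∧length≡⇒≡ : ∀ {β} α → β ≤C α → length β ≡ length α → β ≡ α
≤C∧length≡⇒≡ α β≤α eq with gs , split , refl ← ≤C⁻ {α = α} β≤α =
  trans (cong (map sum) (finest-split split (trans (sym (length-map sum gs)) eq))) (sum-singletons α)

<C⇒length< : ∀ {β} α → β ≤C α → β ≢ α → length β < length α
<C⇒length< α β≤α β≢α = ℕ.≤∧≢⇒< (≤C⇒length≤ α β≤α) (β≢α ∘ ≤C∧length≡⇒≡ α β≤α)

-- The Möbius recursion

filter-filter : {P Q : A → Set} (P? : Decidable P) (Q? : Decidable Q) (xs : List A) →
  filter P? (filter Q? xs) ≡ filter (λ x → P? x ×-dec Q? x) xs
filter-filter P? Q? []       = refl
filter-filter P? Q? (x ∷ xs) with does (Q? x)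
... | false with does (P? x)
...   | true  = filter-filter P? Q? xs
...   | false = filter-filter P? Q? xs
filter-filter P? Q? (x ∷ xs) | true with does (P? x)
...   | true  = cong (x ∷_) (filter-filter P? Q? xs)
...   | false = filter-filter P? Q? xs

-- The fuel in mobF bounds the rank, here the number of shorter elements of the poset.
rank : List (List ℕ) → List ℕ → ℕ
rank P y = length (filter (λ w → length w ℕ.<? length y) P)

rank-mono-< : ∀ P {z y} → z ∈ P → length z < length y → rank P z < rank P y
rank-mono-< P {z} {y} z∈ z<y = begin-strict
  rank P z                       ≡⟨ cong length (filter-≐ (shorter z) both ((λ w<z → w<z , ℕ.<-trans w<z z<y) , proj₁) P) ⟩
  length (filter both P)         ≡⟨ cong length (filter-filter (shorter z) (shorter y) P) ⟨
  length (filter (shorter z) (filter (shorter y) P))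
    <⟨ filter-notAll (shorter z) _ (lose (∈-filter⁺ (shorter y) z∈ z<y) (ℕ.<-irrefl refl)) ⟩
  rank P y                       ∎
  where
  open ≤-Reasoning
  shorter : ∀ x (w : List ℕ) → Dec (length w < length x)
  shorter x w = length w ℕ.<? length x
  both : ∀ (w : List ℕ) → Dec (length w < length z × length w < length y)
  both w = shorter z w ×-dec shorter y w

rank< : ∀ P {y} → y ∈ P → rank P y < length P
rank< P {y} y∈ = filter-notAll (λ w → length w ℕ.<? length y) P (lose y∈ (ℕ.<-irrefl refl))

between? : ∀ x y z → Dec (x ≤C z × z ≤C y × z ≢ y)
between? x y z = (x ≤C? z) ×-dec ((z ≤C? y) ×-dec ¬? (≡-dec ℕ._≟_ z y))

-- A recursive call moves to a shorter composition, hence to a smaller rank, so fuel above the rank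
-- never runs out. With this the Möbius recursion holds for one function `mobOdd` on both sides,
-- although the recursive calls have less fuel.
mobF-fuel : ∀ P f f′ x y → rank P y < f → rank P y < f′ → mobF P f x y ≡ mobF P f′ x y
mobF-fuel P (suc f) (suc f′) x y (s≤s r) (s≤s r′) with ≡-dec ℕ._≟_ x y | x ≤C? y
... | yes _ | _     = refl
... | no _  | yes _ = cong -_ (∑-cong (filter (between? x y) P) λ {z} z∈ →
  let z∈P , _ , z≤y , z≢y = ∈-filter⁻ (between? x y) {xs = P} z∈
      z<y = rank-mono-< P {z} {y} z∈P (<C⇒length< y z≤y z≢y)
  in mobF-fuel P f f′ x z (ℕ.<-≤-trans z<y r) (ℕ.<-≤-trans z<y r′))
... | no _  | no _  = refl

mobF-≰ : ∀ P f x y → ¬ x ≤C y → mobF P f x y ≡ 0ℤ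
mobF-≰ P zero    x y x≰y = refl
mobF-≰ P (suc f) x y x≰y with ≡-dec ℕ._≟_ x y | x ≤C? y
... | yes refl | _       = contradiction (≤C-refl x) x≰y
... | no _     | yes x≤y = contradiction x≤y x≰y
... | no _     | no _    = refl

mobF-refl : ∀ P f x → mobF P (suc f) x x ≡ 1ℤ
mobF-refl P f x with ≡-dec ℕ._≟_ x x | x ≤C? x
... | yes _  | _ = refl
... | no x≢x | _ = contradiction refl x≢x

mobF-< : ∀ P f x y → x ≢ y → x ≤C y → mobF P (suc f) x y ≡ - ∑ (filter (between? x y) P) (mobF P f x)
mobF-< P f x y x≢y x≤y with ≡-dec ℕ._≟_ x y | x ≤C? y
... | yes x≡y | _      = contradiction x≡y x≢y
... | no _    | yes _  = refl
... | no _    | no x≰y = contradiction x≤y x≰y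

-- The defining recursion with its top term moved to the other side. As μ(β,γ) vanishes unless β ≤
-- γ, the interval from β to δ may be replaced by the lower set of δ, which no longer depends on β.
mobOdd-sum : ∀ L {β δ} → β ∈ oddCompositions L → δ ∈ oddCompositions L → β ≢ δ →
  ∑ (filter (_≤C? δ) (oddCompositions L)) (mobOdd L β) ≡ 0ℤ
mobOdd-sum L {β} {δ} β∈ δ∈ β≢δ with β ≤C? δ
... | no β≰δ = ∑-zero (filter (_≤C? δ) (oddCompositions L)) λ {γ} γ∈ →
  mobF-≰ (oddCompositions L) (length (oddCompositions L)) β γ λ β≤γ →
    β≰δ (≤C-trans {α = δ} β≤γ (proj₂ (∈-filter⁻ (_≤C? δ) {xs = oddCompositions L} γ∈)))
... | yes β≤δ = begin
  ∑ (filter (_≤C? δ) P) mob                                  ≡⟨ ∑-filter (_≤C? δ) P ⟩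
  ∑ P (λ γ → if does (γ ≤C? δ) then mob γ else 0ℤ)           ≡⟨ ∑-cong P (λ {γ} _ → split γ) ⟩
  ∑ P (λ γ → below γ + top γ)                                ≡⟨ ∑-+ P below top ⟩
  ∑ P below + ∑ P top                                        ≡⟨ cong₂ _+_ (sym (∑-filter (between? β δ) P)) (∑-single top (oddCompositions-unique L) δ∈ top-≢) ⟩
  ∑ (filter (between? β δ) P) mob + top δ                    ≡⟨ +-congˡ (∑ (filter (between? β δ) P) mob) (trans top-≡ mob-δ) ⟩
  ∑ (filter (between? β δ) P) mob - ∑ (filter (between? β δ) P) mob ≡⟨ ℤ.+-inverseʳ (∑ (filter (between? β δ) P) mob) ⟩
  0ℤ                                                         ∎
  where
  open ≡-Reasoning
  P = oddCompositions L
  mob = mobOdd L β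
  below top : List ℕ → ℤ
  below γ = if does (between? β δ γ) then mob γ else 0ℤ
  top γ   = if does (≡-dec ℕ._≟_ γ δ) then mob γ else 0ℤ
  top-≢ : ∀ {γ} → γ ∈ P → γ ≢ δ → top γ ≡ 0ℤ
  top-≢ {γ} _ γ≢δ with ≡-dec ℕ._≟_ γ δ
  ... | yes γ≡δ = contradiction γ≡δ γ≢δ
  ... | no _    = refl
  top-≡ : top δ ≡ mob δ
  top-≡ with ≡-dec ℕ._≟_ δ δ
  ... | yes _  = refl
  ... | no δ≢δ = contradiction refl δ≢δ
  split : ∀ γ → (if does (γ ≤C? δ) then mob γ else 0ℤ) ≡ below γ + top γ
  split γ with β ≤C? γ | γ ≤C? δ | ≡-dec ℕ._≟_ γ δ
  ... | _       | no γ≰δ | yes refl = contradiction (≤C-refl γ) γ≰δ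
  ... | yes _   | no _   | no _     = refl
  ... | no _    | no _   | no _     = refl
  ... | yes _   | yes _  | yes _    = sym (ℤ.+-identityˡ _)
  ... | no _    | yes _  | yes _    = sym (ℤ.+-identityˡ _)
  ... | yes _   | yes _  | no _     = sym (ℤ.+-identityʳ _)
  ... | no β≰γ  | yes _  | no _     = mobF-≰ P (length P) β γ β≰γ
  mob-δ : mob δ ≡ - ∑ (filter (between? β δ) P) mob
  mob-δ = trans (mobF-fuel P (length P) (suc (length P)) β δ (rank< P δ∈) (ℕ.m<n⇒m<1+n (rank< P δ∈)))
                (mobF-< P (length P) β δ β≢δ β≤δ)

-- The sum that defines `μ L`, with an arbitrary γ in place of (1,...,1).
oddWeight : ℕ → List ℕ → ℤ
oddWeight L γ = ∑ (oddCompositions L) (λ β → mobOdd L β γ)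

mobOdd-refl : ∀ L {δ} → δ ∈ oddCompositions L → mobOdd L δ δ ≡ 1ℤ
mobOdd-refl L {δ} δ∈ = trans (mobF-fuel P (length P) (suc (length P)) δ δ (rank< P δ∈) (ℕ.m<n⇒m<1+n (rank< P δ∈)))
                             (mobF-refl P (length P) δ)
  where P = oddCompositions L

-- After the sums are exchanged, `mobOdd-sum` removes every β other than δ, and for β = δ
-- antisymmetry leaves only γ = δ.
oddWeight-sum : ∀ L {δ} → δ ∈ oddCompositions L →
  ∑ (filter (_≤C? δ) (oddCompositions L)) (oddWeight L) ≡ 1ℤ
oddWeight-sum L {δ} δ∈ = begin
  ∑ below (λ γ → ∑ P (λ β → mobOdd L β γ))  ≡⟨ ∑-swap below P (λ γ β → mobOdd L β γ) ⟩
  ∑ P (λ β → ∑ below (mobOdd L β))          ≡⟨ ∑-single _ (oddCompositions-unique L) δ∈ (λ β∈ → mobOdd-sum L β∈ δ∈) ⟩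
  ∑ below (mobOdd L δ)                      ≡⟨ ∑-single (mobOdd L δ) (Unique.filter⁺ (_≤C? δ) (oddCompositions-unique L)) (∈-filter⁺ (_≤C? δ) δ∈ (≤C-refl δ)) vanish ⟩
  mobOdd L δ δ                              ≡⟨ mobOdd-refl L δ∈ ⟩
  1ℤ                                        ∎
  where
  open ≡-Reasoning
  P = oddCompositions L
  below = filter (_≤C? δ) P
  vanish : ∀ {γ} → γ ∈ below → γ ≢ δ → mobOdd L δ γ ≡ 0ℤ
  vanish {γ} γ∈ γ≢δ = mobF-≰ P (length P) δ γ λ δ≤γ →
    let γ≤δ = proj₂ (∈-filter⁻ (_≤C? δ) {xs = P} γ∈)
    in γ≢δ (≤C∧length≡⇒≡ δ γ≤δ (ℕ.≤-antisym (≤C⇒length≤ δ γ≤δ) (≤C⇒length≤ γ δ≤γ)))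

-- Parity, and splits into groups of odd length

odd : ℕ → Bool
odd n = does (isOdd? n)

odd-suc : ∀ n → odd (suc n) ≡ not (odd n)
odd-suc zero          = refl
odd-suc (suc zero)    = refl
odd-suc (suc (suc n)) = odd-suc n

odd-+ : ∀ {a} b → IsOdd a → odd (a ℕ.+ b) ≡ not (odd b)
odd-+ {suc zero}    b _ = odd-suc b
odd-+ {suc (suc a)} b o = odd-+ {a} b o

odd⁺ : ∀ {n} → IsOdd n → odd n ≡ true
odd⁺ {n} o = dec-true (isOdd? n) o

odd⁻ : ∀ {n} → odd n ≡ true → IsOdd n
odd⁻ {n} eq = ℕ.≡ᵇ⇒≡ (n ℕ.% 2) 1 (subst T (sym eq) tt)

-- This makes the odd compositions below an odd δ correspond to the splits of δ into groups of odd
-- length, whatever the parts of δ are.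
odd-sum : ∀ {α} → All IsOdd α → odd (sum α) ≡ odd (length α)
odd-sum         []             = refl
odd-sum {a ∷ α} (odd-a ∷ odds) =
  trans (odd-+ {a} (sum α) odd-a) (trans (cong not (odd-sum odds)) (sym (odd-suc (length α))))

oddSplit? : (gs : List (List A)) → Dec (All (IsOdd ∘ length) gs)
oddSplit? = All.all? (isOdd? ∘ length)

shift : (ℕ → ℤ) → ℕ → ℤ
shift m j = m (suc j)

-- oddSplitSum m j is the sum of m ℓ over the splits of a j-element list into ℓ odd groups;
-- in evenHeadSum the first of the ℓ groups is even and nonempty.
mutual
  oddSplitSum : (ℕ → ℤ) → ℕ → ℤ
  oddSplitSum m zero    = m 0
  oddSplitSum m (suc j) = evenHeadSum m j + oddSplitSum (shift m) j

  evenHeadSum : (ℕ → ℤ) → ℕ → ℤ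
  evenHeadSum m zero          = 0ℤ
  evenHeadSum m (suc zero)    = 0ℤ
  evenHeadSum m (suc (suc j)) = oddSplitSum m (suc j)

oddSplitWeight evenHeadWeight : (ℕ → ℤ) → List (List A) → ℤ
oddSplitWeight m gs = if does (oddSplit? gs) then m (length gs) else 0ℤ
evenHeadWeight m []       = 0ℤ
evenHeadWeight m (g ∷ gs) = if not (odd (length g)) ∧ does (oddSplit? gs) then m (suc (length gs)) else 0ℤ

mutual
  ∑-oddSplitWeight : ∀ m (xs : List A) → ∑ (allSplits xs) (oddSplitWeight m) ≡ oddSplitSum m (length xs)
  ∑-oddSplitWeight m []       = ℤ.+-identityʳ _
  ∑-oddSplitWeight m (x ∷ xs) = begin
    ∑ (allSplits (x ∷ xs)) (oddSplitWeight m)                          ≡⟨ ∑-concatMap (extend x) (allSplits xs) ⟩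
    ∑ (allSplits xs) (λ gs → ∑ (extend x gs) (oddSplitWeight m))       ≡⟨ ∑-cong (allSplits xs) (λ {gs} _ → step gs) ⟩
    ∑ (allSplits xs) (λ gs → evenHeadWeight m gs + oddSplitWeight (shift m) gs)
      ≡⟨ ∑-+ (allSplits xs) (evenHeadWeight m) (oddSplitWeight (shift m)) ⟩
    ∑ (allSplits xs) (evenHeadWeight m) + ∑ (allSplits xs) (oddSplitWeight (shift m))
      ≡⟨ cong₂ _+_ (∑-evenHeadWeight m xs) (∑-oddSplitWeight (shift m) xs) ⟩
    oddSplitSum m (suc (length xs))                                    ∎
    where
    open ≡-Reasoning
    -- Either `x` joins the first group, which must then have been even, or it is an odd group of
    -- its own and raises the number of groups by one, hence `shift`.
    step : ∀ gs → ∑ (extend x gs) (oddSplitWeight m) ≡ evenHeadWeight m gs + oddSplitWeight (shift m) gs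
    step []       = ℤ.+-comm (m 1) 0ℤ
    step (g ∷ gs) rewrite odd-suc (length g) = +-congˡ (evenHeadWeight m (g ∷ gs)) (ℤ.+-identityʳ _)

  ∑-evenHeadWeight : ∀ m (xs : List A) → ∑ (allSplits xs) (evenHeadWeight m) ≡ evenHeadSum m (length xs)
  ∑-evenHeadWeight m []           = refl
  ∑-evenHeadWeight m (x ∷ [])     = refl
  ∑-evenHeadWeight m (x ∷ y ∷ xs) = begin
    ∑ (allSplits (x ∷ y ∷ xs)) (evenHeadWeight m)                     ≡⟨ ∑-concatMap (extend x) (allSplits (y ∷ xs)) ⟩
    ∑ (allSplits (y ∷ xs)) (λ gs → ∑ (extend x gs) (evenHeadWeight m)) ≡⟨ ∑-cong (allSplits (y ∷ xs)) (λ {gs} gs∈ → step gs (proj₂ (∈-allSplits⁻ (y ∷ xs) gs∈))) ⟩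
    ∑ (allSplits (y ∷ xs)) (oddSplitWeight m)                         ≡⟨ ∑-oddSplitWeight m (y ∷ xs) ⟩
    oddSplitSum m (suc (length xs))                                   ∎
    where
    open ≡-Reasoning
    -- A new singleton head is odd and contributes nothing, and `x ∷ g` is even exactly if `g` is
    -- odd. The empty split breaks this rule, so `evenHeadSum m 1` is 0 and not `oddSplitSum m 0`.
    step : ∀ gs → concat gs ≡ y ∷ xs → ∑ (extend x gs) (evenHeadWeight m) ≡ oddSplitWeight m gs
    step (g ∷ gs) _ rewrite odd-suc (length g) with odd (length g)
    ... | true  = ℤ.+-identityʳ _
    ... | false = refl

mutual
  oddSplitSum-cong : ∀ j {m m′ : ℕ → ℤ} → (∀ {i} → i ≤ j → m i ≡ m′ i) → oddSplitSum m j ≡ oddSplitSum m′ j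
  oddSplitSum-cong zero    eq = eq z≤n
  oddSplitSum-cong (suc j) eq = cong₂ _+_ (evenHeadSum-cong j (eq ∘ ℕ.m≤n⇒m≤1+n)) (oddSplitSum-cong j (eq ∘ s≤s))

  evenHeadSum-cong : ∀ j {m m′ : ℕ → ℤ} → (∀ {i} → i ≤ j → m i ≡ m′ i) → evenHeadSum m j ≡ evenHeadSum m′ j
  evenHeadSum-cong zero          eq = refl
  evenHeadSum-cong (suc zero)    eq = refl
  evenHeadSum-cong (suc (suc j)) eq = oddSplitSum-cong (suc j) (eq ∘ ℕ.m≤n⇒m≤1+n)

-- The finest split contributes m j to oddSplitSum m j, all others only involve smaller indices.
oddSplitSum-exchange : ∀ j {m m′ : ℕ → ℤ} → (∀ {i} → i < j → m i ≡ m′ i) →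
  oddSplitSum m j + m′ j ≡ oddSplitSum m′ j + m j
oddSplitSum-exchange zero    {m} {m′} eq = ℤ.+-comm (m 0) (m′ 0)
oddSplitSum-exchange (suc j) {m} {m′} eq = begin
  evenHeadSum m j + oddSplitSum (shift m) j + m′ (suc j)     ≡⟨ ℤ.+-assoc (evenHeadSum m j) _ _ ⟩
  evenHeadSum m j + (oddSplitSum (shift m) j + m′ (suc j))   ≡⟨ cong₂ _+_ (evenHeadSum-cong j (eq ∘ s≤s)) (oddSplitSum-exchange j (eq ∘ s≤s)) ⟩
  evenHeadSum m′ j + (oddSplitSum (shift m′) j + m (suc j))  ≡⟨ ℤ.+-assoc (evenHeadSum m′ j) _ _ ⟨
  evenHeadSum m′ j + oddSplitSum (shift m′) j + m (suc j)    ∎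
  where open ≡-Reasoning

-- Lower sets of odd compositions and the dependence of weights on length

prefix-≡ : ∀ {g h G H : List ℕ} → All (0 <_) (g ++ G) → g ++ G ≡ h ++ H → sum g ≡ sum h → g ≡ h
prefix-≡ {[]}    {[]}    pos       eq   s = refl
prefix-≡ {[]}    {y ∷ h} pos       refl s = contradiction s (ℕ.<⇒≢ (ℕ.<-≤-trans (All.head pos) (ℕ.m≤m+n y (sum h))))
prefix-≡ {x ∷ g} {[]}    pos       eq   s = contradiction (sym s) (ℕ.<⇒≢ (ℕ.<-≤-trans (All.head pos) (ℕ.m≤m+n x (sum g))))
prefix-≡ {x ∷ g} {y ∷ h} (_ ∷ pos) eq   s with refl , eq′ ← ∷-injective eq =
  cong (x ∷_) (prefix-≡ pos eq′ (ℕ.+-cancelˡ-≡ x _ _ s))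

-- Positive parts have strictly increasing partial sums, so the sum of the first group locates its
-- end. Hence summing over splits counts no element of a lower set twice.
map-sum-injective : ∀ {α gs hs} → All (0 <_) α → IsSplit α gs → IsSplit α hs → map sum gs ≡ map sum hs → gs ≡ hs
map-sum-injective {gs = []}     {[]}     pos _ _ _ = refl
map-sum-injective {gs = g ∷ gs} {h ∷ hs} pos (_ ∷ gs≢[] , refl) (_ ∷ hs≢[] , hs≡) eq
  with refl ← prefix-≡ {g} {h} pos (sym hs≡) (∷-injectiveˡ eq) =
  cong (g ∷_) (map-sum-injective (All.++⁻ʳ g pos) (gs≢[] , refl) (hs≢[] , ++-cancelˡ g _ _ hs≡) (∷-injectiveʳ eq))

odd-sums : ∀ {gs} → All IsOdd (concat gs) → All (IsOdd ∘ length) gs → All IsOdd (map sum gs)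
odd-sums {[]}     odds []       = []
odd-sums {g ∷ gs} odds (o ∷ os) =
  odd⁻ {sum g} (trans (odd-sum (All.++⁻ˡ g odds)) (odd⁺ {length g} o)) ∷ odd-sums (All.++⁻ʳ g odds) os

odd-lengths : ∀ {gs} → All IsOdd (concat gs) → All IsOdd (map sum gs) → All (IsOdd ∘ length) gs
odd-lengths {[]}     odds []       = []
odd-lengths {g ∷ gs} odds (o ∷ os) =
  odd⁻ {length g} (trans (sym (odd-sum (All.++⁻ˡ g odds))) (odd⁺ {sum g} o)) ∷ odd-lengths (All.++⁻ʳ g odds) os

∈-lowerSet : ∀ {L δ gs} → δ ∈ oddCompositions L → gs ∈ filter oddSplit? (allSplits δ) → map sum gs ∈ oddCompositions L
∈-lowerSet {L} {δ} {gs} δ∈ gs∈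
  with gs∈ , odds ← ∈-filter⁻ oddSplit? {xs = allSplits δ} gs∈
  with ∈-oddCompositions⁻ {L} δ∈ | ∈-allSplits⁻ δ gs∈
... | odd-δ , refl | _ , refl =
  subst (λ l → map sum gs ∈ oddCompositions l) (sym (sum-concat gs)) (∈-oddCompositions⁺ (odd-sums odd-δ odds))

∑-lowerSet : ∀ L {δ} → δ ∈ oddCompositions L → (G : List ℕ → ℤ) →
  ∑ (filter (_≤C? δ) (oddCompositions L)) G ≡ ∑ (filter oddSplit? (allSplits δ)) (G ∘ map sum)
∑-lowerSet L {δ} δ∈ G = trans
  (∑-set G (Unique.filter⁺ (_≤C? δ) (oddCompositions-unique L))
    (map-unique injective (Unique.filter⁺ oddSplit? (allSplits-unique δ)))
    to from)
  (∑-map (map sum) (filter oddSplit? (allSplits δ)))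
  where
  odd-δ = proj₁ (∈-oddCompositions⁻ {L} δ∈)
  splits : ∀ {gs} → gs ∈ filter oddSplit? (allSplits δ) → IsSplit δ gs
  splits gs∈ = ∈-allSplits⁻ δ (proj₁ (∈-filter⁻ oddSplit? {xs = allSplits δ} gs∈))
  injective : ∀ {gs hs} → gs ∈ filter oddSplit? (allSplits δ) → hs ∈ filter oddSplit? (allSplits δ) →
    map sum gs ≡ map sum hs → gs ≡ hs
  injective gs∈ hs∈ = map-sum-injective (All.map (odd⇒positive _) odd-δ) (splits gs∈) (splits hs∈)
  to : ∀ {γ} → γ ∈ filter (_≤C? δ) (oddCompositions L) → γ ∈ map (map sum) (filter oddSplit? (allSplits δ))
  to γ∈ with γ∈ , γ≤δ ← ∈-filter⁻ (_≤C? δ) {xs = oddCompositions L} γ∈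
        with gs , (ne , refl) , refl ← ≤C⁻ {α = δ} γ≤δ =
    ∈-map⁺ (map sum) (∈-filter⁺ oddSplit? (∈-allSplits⁺ δ (ne , refl))
      (odd-lengths odd-δ (proj₁ (∈-oddCompositions⁻ {L} γ∈))))
  from : ∀ {γ} → γ ∈ map (map sum) (filter oddSplit? (allSplits δ)) → γ ∈ filter (_≤C? δ) (oddCompositions L)
  from γ∈ with gs , gs∈ , refl ← ∈-map⁻ (map sum) γ∈ =
    ∈-filter⁺ (_≤C? δ) (∈-lowerSet {L} δ∈ gs∈) (≤C⁺ (splits gs∈) refl)

sum-ones : ∀ l → sum (replicate l 1) ≡ l
sum-ones zero    = refl
sum-ones (suc l) = cong suc (sum-ones l)

-- The step of a strong induction on the length. With the values at smaller indices known from `ih`,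
-- both `oddWeight L δ` and `μ l` solve `oddSplitSum m l ≡ 1ℤ` for the value of m at l. Only the
-- finest split involves that value, so the solution is unique. `override` puts a candidate for it
-- into μ.
module OddWeight (l : ℕ) (ih : ∀ {j} → j < l → ∀ L {δ} → δ ∈ oddCompositions L → length δ ≡ j → oddWeight L δ ≡ μ j) where

  override : ℤ → ℕ → ℤ
  override w j = if does (j ℕ.≟ l) then w else μ j

  override-≢ : ∀ w {j} → j ≢ l → override w j ≡ μ j
  override-≢ w {j} j≢l = cong (λ b → if b then w else μ j) (dec-false (j ℕ.≟ l) j≢l)

  override-≡ : ∀ w → override w l ≡ w
  override-≡ w = cong (λ b → if b then w else μ l) (dec-true (l ℕ.≟ l) refl)

  oddSplitSum-override : ∀ L {δ} → δ ∈ oddCompositions L → length δ ≡ l →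
    oddSplitSum (override (oddWeight L δ)) l ≡ 1ℤ
  oddSplitSum-override L {δ} δ∈ refl = begin
    oddSplitSum m (length δ)                                        ≡⟨ ∑-oddSplitWeight m δ ⟨
    ∑ (allSplits δ) (oddSplitWeight m)                              ≡⟨ ∑-filter oddSplit? (allSplits δ) ⟨
    ∑ (filter oddSplit? (allSplits δ)) (m ∘ length)                 ≡⟨ ∑-cong (filter oddSplit? (allSplits δ)) weight ⟨
    ∑ (filter oddSplit? (allSplits δ)) (oddWeight L ∘ map sum)      ≡⟨ ∑-lowerSet L δ∈ (oddWeight L) ⟨
    ∑ (filter (_≤C? δ) (oddCompositions L)) (oddWeight L)           ≡⟨ oddWeight-sum L δ∈ ⟩
    1ℤ                                                              ∎
    where
    open ≡-Reasoning
    m = override (oddWeight L δ)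
    weight : ∀ {gs} → gs ∈ filter oddSplit? (allSplits δ) → oddWeight L (map sum gs) ≡ m (length gs)
    weight {gs} gs∈ with ∈-allSplits⁻ δ (proj₁ (∈-filter⁻ oddSplit? {xs = allSplits δ} gs∈)) | length gs ℕ.≟ length δ
    ... | split | yes eq = trans (cong (oddWeight L) (trans (cong (map sum) (finest-split split eq)) (sum-singletons δ)))
                                 (sym (trans (cong m eq) (override-≡ (oddWeight L δ))))
    ... | split | no neq = trans (ih (ℕ.≤∧≢⇒< (length-split split) neq) L (∈-lowerSet {L} δ∈ gs∈) (length-map sum gs))
                                 (sym (override-≢ (oddWeight L δ) neq))

  ones∈ : replicate l 1 ∈ oddCompositions l
  ones∈ = subst (λ k → replicate l 1 ∈ oddCompositions k) (sum-ones l)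
            (∈-oddCompositions⁺ (All.replicate⁺ l refl))

  oddSplitSum-μ : oddSplitSum μ l ≡ 1ℤ
  -- The weight of (1,...,1) is `μ l` by definition, so overriding with it changes nothing.
  oddSplitSum-μ = trans (oddSplitSum-cong l eq) (oddSplitSum-override l ones∈ (length-replicate l))
    where
    eq : ∀ {i} → i ≤ l → μ i ≡ override (μ l) i
    eq {i} _ with i ℕ.≟ l
    ... | yes refl = sym (override-≡ (μ l))
    ... | no i≢l   = sym (override-≢ (μ l) i≢l)

  oddWeight-μ : ∀ L {δ} → δ ∈ oddCompositions L → length δ ≡ l → oddWeight L δ ≡ μ l
  oddWeight-μ L {δ} δ∈ len = trans (sym (override-≡ w)) (sym (∸-cancel
    (oddSplitSum-exchange l (override-≢ w ∘ ℕ.<⇒≢)) (trans (oddSplitSum-override L δ∈ len) (sym oddSplitSum-μ))))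
    where
    w = oddWeight L δ
    ∸-cancel : ∀ {a b c d} → a + b ≡ c + d → a ≡ c → b ≡ d
    ∸-cancel {a} {b} {_} {d} eq refl = ∙-cancelˡ a b d eq

oddWeight-μ : ∀ l L {δ} → δ ∈ oddCompositions L → length δ ≡ l → oddWeight L δ ≡ μ l
oddWeight-μ = <-rec _ λ l ih → OddWeight.oddWeight-μ l ih

oddSplitSum-μ : ∀ l → oddSplitSum μ l ≡ 1ℤ
oddSplitSum-μ l = OddWeight.oddSplitSum-μ l (λ {j} _ → oddWeight-μ j)

-- Power series in several variables

-- A series in k variables is read off on the lists of length k, as a function of the exponents.
Series : Set
Series = List ℕ → ℤ

infix  4 _≈_ _≈[_]_
infixl 6 _⊕_
infixl 7 _⊛_

_≈_ : Series → Series → Set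
f ≈ g = ∀ as → f as ≡ g as

_⊕_ : Series → Series → Series
(f ⊕ g) as = f as + g as

𝟘 𝟙 : Series
𝟘 as = 0ℤ
𝟙 []           = 1ℤ
𝟙 (zero ∷ as)  = 𝟙 as
𝟙 (suc a ∷ as) = 0ℤ

coeff : ℕ → Series → Series
coeff i f as = f (i ∷ as)

tail : Series → Series
tail f []       = 0ℤ
tail f (i ∷ as) = f (suc i ∷ as)

-- The Cauchy product. In the first variable x it uses f = f₀ + x · `tail f`, so the coefficient of
-- fg at x^(a+1) is that of f₀g plus the coefficient of `tail f` · g at x^a.
_⊛_ : Series → Series → Series
(f ⊛ g) []           = f [] * g []
(f ⊛ g) (zero ∷ as)  = (coeff 0 f ⊛ coeff 0 g) as
(f ⊛ g) (suc a ∷ as) = (coeff 0 f ⊛ coeff (suc a) g) as + (tail f ⊛ g) (a ∷ as)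

-- Only pairs of exponents whose degrees add up to the degree of `as` enter the product. Keeping the
-- degrees lets this one induction serve equality of series as well as the truncated versions
-- `⊛-congˡ[]` and `⊛-raise`.
⊛-cong-sum : ∀ {f f′ g g′} as → (∀ v w → sum v ℕ.+ sum w ≡ sum as → f v * g w ≡ f′ v * g′ w) →
  (f ⊛ g) as ≡ (f′ ⊛ g′) as
⊛-cong-sum []           eq = eq [] [] refl
⊛-cong-sum (zero ∷ as)  eq = ⊛-cong-sum as (λ v w → eq (0 ∷ v) (0 ∷ w))
⊛-cong-sum {f} {f′} {g} {g′} (suc a ∷ as) eq = cong₂ _+_
  (⊛-cong-sum as (λ v w s → eq (0 ∷ v) (suc a ∷ w) (trans (ℕ-x∙yz≈y∙xz (sum v) (suc a) (sum w)) (cong (suc a ℕ.+_) s))))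
  (⊛-cong-sum (a ∷ as) shifted)
  where
  shifted : ∀ v w → sum v ℕ.+ sum w ≡ sum (a ∷ as) → tail f v * g w ≡ tail f′ v * g′ w
  shifted []      w s = trans (ℤ.*-zeroˡ (g w)) (sym (ℤ.*-zeroˡ (g′ w)))
  shifted (i ∷ v) w s = eq (suc i ∷ v) w (cong suc s)

⊛-cong : ∀ {f f′ g g′} → f ≈ f′ → g ≈ g′ → f ⊛ g ≈ f′ ⊛ g′
⊛-cong f≈ g≈ as = ⊛-cong-sum as (λ v w _ → cong₂ _*_ (f≈ v) (g≈ w))

⊛-zeroˡ : ∀ g → 𝟘 ⊛ g ≈ 𝟘
⊛-zeroˡ g as = trans (⊛-cong-sum {g′ = 𝟘} as (λ v w _ → ℤ.*-zeroˡ (g w))) (zero-zero as)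
  where
  zero-zero : 𝟘 ⊛ 𝟘 ≈ 𝟘
  zero-zero []           = refl
  zero-zero (zero ∷ as)  = zero-zero as
  zero-zero (suc a ∷ as) = cong₂ _+_ (zero-zero as)
    (trans (⊛-cong {g = 𝟘} (λ { [] → refl ; (_ ∷ _) → refl }) (λ _ → refl) (a ∷ as)) (zero-zero (a ∷ as)))

⊛-distribʳ : ∀ g f f′ → (f ⊕ f′) ⊛ g ≈ f ⊛ g ⊕ f′ ⊛ g
⊛-distribʳ g f f′ []           = ℤ.*-distribʳ-+ (g []) (f []) (f′ [])
⊛-distribʳ g f f′ (zero ∷ as)  = ⊛-distribʳ (coeff 0 g) (coeff 0 f) (coeff 0 f′) as
⊛-distribʳ g f f′ (suc a ∷ as) = trans
  (cong₂ _+_ (⊛-distribʳ (coeff (suc a) g) (coeff 0 f) (coeff 0 f′) as)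
    (trans (⊛-cong {g = g} (λ { [] → refl ; (_ ∷ _) → refl }) (λ _ → refl) (a ∷ as))
           (⊛-distribʳ g (tail f) (tail f′) (a ∷ as))))
  (interchange ((coeff 0 f ⊛ coeff (suc a) g) as) _ _ _)

-- The recursion of `_⊛_` consumes its left factor; commutativity needs this mirror image.
⊛-unfoldʳ : ∀ f g a as → (f ⊛ g) (suc a ∷ as) ≡ (coeff (suc a) f ⊛ coeff 0 g) as + (f ⊛ tail g) (a ∷ as)
⊛-unfoldʳ f g zero    as = ℤ.+-comm ((coeff 0 f ⊛ coeff 1 g) as) _
⊛-unfoldʳ f g (suc a) as = trans
  (+-congˡ ((coeff 0 f ⊛ coeff (suc (suc a)) g) as) (⊛-unfoldʳ (tail f) g a as))
  (x∙yz≈y∙xz ((coeff 0 f ⊛ coeff (suc (suc a)) g) as) ((coeff (suc (suc a)) f ⊛ coeff 0 g) as) _)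

⊛-comm : ∀ f g → f ⊛ g ≈ g ⊛ f
⊛-comm f g []           = ℤ.*-comm (f []) (g [])
⊛-comm f g (zero ∷ as)  = ⊛-comm (coeff 0 f) (coeff 0 g) as
⊛-comm f g (suc a ∷ as) = trans
  (cong₂ _+_ (⊛-comm (coeff 0 f) (coeff (suc a) g) as) (⊛-comm (tail f) g (a ∷ as)))
  (sym (⊛-unfoldʳ g f a as))

⊛-distribˡ : ∀ f g g′ → f ⊛ (g ⊕ g′) ≈ f ⊛ g ⊕ f ⊛ g′
⊛-distribˡ f g g′ as = trans (⊛-comm f (g ⊕ g′) as)
  (trans (⊛-distribʳ f g g′ as) (cong₂ _+_ (⊛-comm g f as) (⊛-comm g′ f as)))

-- Multiplication by a series free of the first variable. It arises in associativity from tail (fg)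
-- = f₀ · tail g + tail f · g.
scale : Series → Series → Series
scale c g []       = 0ℤ
scale c g (i ∷ as) = (c ⊛ coeff i g) as

mutual
  ⊛-assoc : ∀ f g h → (f ⊛ g) ⊛ h ≈ f ⊛ (g ⊛ h)
  ⊛-assoc f g h []           = ℤ.*-assoc (f []) (g []) (h [])
  ⊛-assoc f g h (zero ∷ as)  = ⊛-assoc (coeff 0 f) (coeff 0 g) (coeff 0 h) as
  ⊛-assoc f g h (suc a ∷ as) = begin
    ((f₀ ⊛ coeff 0 g) ⊛ h₊) as + (tail (f ⊛ g) ⊛ h) (a ∷ as)
      ≡⟨ cong₂ _+_ (⊛-assoc f₀ (coeff 0 g) h₊ as)
           (trans (⊛-cong {g = h} tail-⊛ (λ _ → refl) (a ∷ as)) (⊛-distribʳ h (scale f₀ (tail g)) (tail f ⊛ g) (a ∷ as))) ⟩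
    (f₀ ⊛ (coeff 0 g ⊛ h₊)) as + ((scale f₀ (tail g) ⊛ h) (a ∷ as) + ((tail f ⊛ g) ⊛ h) (a ∷ as))
      ≡⟨ +-congˡ ((f₀ ⊛ (coeff 0 g ⊛ h₊)) as) (cong₂ _+_ (scale-⊛ f₀ (tail g) h a as) (⊛-assoc (tail f) g h (a ∷ as))) ⟩
    (f₀ ⊛ (coeff 0 g ⊛ h₊)) as + ((f₀ ⊛ coeff a (tail g ⊛ h)) as + (tail f ⊛ (g ⊛ h)) (a ∷ as))
      ≡⟨ ℤ.+-assoc ((f₀ ⊛ (coeff 0 g ⊛ h₊)) as) _ _ ⟨
    (f₀ ⊛ (coeff 0 g ⊛ h₊)) as + (f₀ ⊛ coeff a (tail g ⊛ h)) as + (tail f ⊛ (g ⊛ h)) (a ∷ as)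
      ≡⟨ cong (λ t → t + (tail f ⊛ (g ⊛ h)) (a ∷ as)) (⊛-distribˡ f₀ (coeff 0 g ⊛ h₊) (coeff a (tail g ⊛ h)) as) ⟨
    (f ⊛ (g ⊛ h)) (suc a ∷ as)
      ∎
    where
    open ≡-Reasoning
    f₀ = coeff 0 f
    h₊ = coeff (suc a) h
    tail-⊛ : tail (f ⊛ g) ≈ scale f₀ (tail g) ⊕ tail f ⊛ g
    tail-⊛ []      = sym (cong (λ t → 0ℤ + t) (ℤ.*-zeroˡ (g [])))
    tail-⊛ (_ ∷ _) = refl

  scale-⊛ : ∀ c g h a as → (scale c g ⊛ h) (a ∷ as) ≡ (c ⊛ coeff a (g ⊛ h)) as
  scale-⊛ c g h zero    as = ⊛-assoc c (coeff 0 g) (coeff 0 h) as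
  scale-⊛ c g h (suc a) as = trans
    (cong₂ _+_ (⊛-assoc c (coeff 0 g) (coeff (suc a) h) as)
      (trans (⊛-cong {g = h} (λ { [] → refl ; (_ ∷ _) → refl }) (λ _ → refl) (a ∷ as)) (scale-⊛ c (tail g) h a as)))
    (sym (⊛-distribˡ c (coeff 0 g ⊛ coeff (suc a) h) (coeff a (tail g ⊛ h)) as))

⊛-identityˡ : ∀ f → 𝟙 ⊛ f ≈ f
⊛-identityˡ f []           = ℤ.*-identityˡ (f [])
⊛-identityˡ f (zero ∷ as)  = ⊛-identityˡ (coeff 0 f) as
⊛-identityˡ f (suc a ∷ as) = trans (cong₂ _+_ (⊛-identityˡ (coeff (suc a) f) as)
  (trans (⊛-cong {g = f} (λ { [] → refl ; (_ ∷ _) → refl }) (λ _ → refl) (a ∷ as)) (⊛-zeroˡ f (a ∷ as))))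
  (ℤ.+-identityʳ _)

≈-isEquivalence : IsEquivalence _≈_
≈-isEquivalence = record
  { refl = λ _ → refl ; sym = λ eq as → sym (eq as) ; trans = λ eq eq′ as → trans (eq as) (eq′ as) }

seriesSemiring : CommutativeSemiring _ _
seriesSemiring = record
  { Carrier = Series ; _≈_ = _≈_ ; _+_ = _⊕_ ; _*_ = _⊛_ ; 0# = 𝟘 ; 1# = 𝟙
  ; isCommutativeSemiring = isCommutativeSemiringˡ (record
    { +-isCommutativeMonoid = record
      { isMonoid = record
        { isSemigroup = record
          { isMagma = record { isEquivalence = ≈-isEquivalence ; ∙-cong = λ eq eq′ as → cong₂ _+_ (eq as) (eq′ as) }
          ; assoc = λ f g h as → ℤ.+-assoc (f as) (g as) (h as) }
        ; identity = (λ f as → ℤ.+-identityˡ (f as)) , (λ f as → ℤ.+-identityʳ (f as)) }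
      ; comm = λ f g as → ℤ.+-comm (f as) (g as) }
    ; *-isCommutativeMonoid = record
      { isMonoid = record
        { isSemigroup = record
          { isMagma = record { isEquivalence = ≈-isEquivalence ; ∙-cong = ⊛-cong }
          ; assoc = ⊛-assoc }
        ; identity = ⊛-identityˡ , λ f as → trans (⊛-comm f 𝟙 as) (⊛-identityˡ f as) }
      ; comm = ⊛-comm }
    ; distribʳ = ⊛-distribʳ
    ; zeroˡ = ⊛-zeroˡ }) }

-- Equality of series below a given degree

_≈[_]_ : Series → ℕ → Series → Set
f ≈[ n ] g = ∀ as → sum as < n → f as ≡ g as

import Algebra.Solver.Ring.NaturalCoefficients.Default seriesSemiring as Series
open CommutativeSemiring seriesSemiring using () renaming (refl to ≈-refl; sym to ≈-sym; trans to ≈-trans; setoid to ≈-setoid; +-cong to ⊕-cong)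

≈[_]-setoid : ℕ → Setoid _ _
≈[ n ]-setoid = record
  { Carrier = Series ; _≈_ = λ f g → f ≈[ n ] g
  ; isEquivalence = record
    { refl = λ _ _ → refl ; sym = λ eq as lt → sym (eq as lt) ; trans = λ eq eq′ as lt → trans (eq as lt) (eq′ as lt) } }

⌊_⌋ : ∀ {n f g} → f ≈ g → f ≈[ n ] g
⌊ eq ⌋ as _ = eq as

⊕-cong[] : ∀ {n f f′ g g′} → f ≈[ n ] f′ → g ≈[ n ] g′ → f ⊕ g ≈[ n ] f′ ⊕ g′
⊕-cong[] f≈ g≈ as lt = cong₂ _+_ (f≈ as lt) (g≈ as lt)

⊕-cancelʳ[] : ∀ {n f g} h → f ⊕ h ≈[ n ] g ⊕ h → f ≈[ n ] g
⊕-cancelʳ[] h eq as lt = ∙-cancelʳ (h as) _ _ (eq as lt)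

⊛-congˡ[] : ∀ {n} h {f g} → f ≈[ n ] g → h ⊛ f ≈[ n ] h ⊛ g
⊛-congˡ[] h f≈g as lt = ⊛-cong-sum as λ v w s →
  cong (λ t → h v * t) (f≈g w (ℕ.≤-<-trans (ℕ.≤-trans (ℕ.m≤n+m (sum w) (sum v)) (ℕ.≤-reflexive s)) lt))

-- A factor without constant term gains one degree of precision.
⊛-raise : ∀ {n h f g} → h ≈[ 1 ] 𝟘 → f ≈[ n ] g → h ⊛ f ≈[ suc n ] h ⊛ g
⊛-raise {n} {h} {f} {g} h≈𝟘 f≈g as (s≤s as≤n) = ⊛-cong-sum as λ v w s → step v w s (sum v ℕ.≟ 0)
  where
  step : ∀ v w → sum v ℕ.+ sum w ≡ sum as → Dec (sum v ≡ 0) → h v * f w ≡ h v * g w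
  step v w s (yes v≡0) = trans (cong (λ t → t * f w) h≡0) (trans (ℤ.*-zeroˡ (f w))
    (sym (trans (cong (λ t → t * g w) h≡0) (ℤ.*-zeroˡ (g w)))))
    where h≡0 = h≈𝟘 v (ℕ.≤-reflexive (cong suc v≡0))
  step v w s (no v≢0) = cong (λ t → h v * t) (f≈g w (ℕ.<-≤-trans
    (ℕ.<-≤-trans (ℕ.m<n+m (sum w) (ℕ.n≢0⇒n>0 v≢0)) (ℕ.≤-reflexive s)) as≤n))

weaken : ∀ {n f g} → f ≈[ suc n ] g → f ≈[ n ] g
weaken eq as lt = eq as (ℕ.m<n⇒m<1+n lt)

constant : ℤ → Series
constant c as = c * 𝟙 as

-- The series Q, P, E and F

support : List ℕ → ℕ
support []           = 0
support (zero ∷ as)  = support as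
support (suc a ∷ as) = suc (support as)

-- The truncated `support as ∸ 1` gives Q the constant term 1, as (E+1)/2 requires. P is the
-- numerator of u = P/Q.
Q P E E⁻ F : Series
Q as = + (2 ℕ.^ (support as ∸ 1))
P as = Q as - 𝟙 as
F as = if odd (sum as) then Q as else 0ℤ

E []           = 1ℤ
E (zero ∷ as)  = E as
E (suc a ∷ as) = + 2 * E as

alternate : ℕ → ℤ
alternate zero    = 1ℤ
alternate (suc n) = - alternate n

-- E⁻ is E evaluated at -x, hence 1/E.
E⁻ []           = 1ℤ
E⁻ (zero ∷ as)  = E⁻ as
E⁻ (suc a ∷ as) = (+ 2 * alternate (suc a)) * E⁻ as

E≡2^support : ∀ as → E as ≡ + (2 ℕ.^ support as)
E≡2^support []           = refl
E≡2^support (zero ∷ as)  = E≡2^support as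
E≡2^support (suc a ∷ as) = trans (cong (λ t → + 2 * t) (E≡2^support as)) (sym (ℤ.pos-* 2 (2 ℕ.^ support as)))

𝟙-support : ∀ as → 𝟙 as ≡ (if does (support as ℕ.≟ 0) then 1ℤ else 0ℤ)
𝟙-support []           = refl
𝟙-support (zero ∷ as)  = 𝟙-support as
𝟙-support (suc a ∷ as) = refl

𝟙-sum : ∀ as → sum as ≢ 0 → 𝟙 as ≡ 0ℤ
𝟙-sum []           ne = contradiction refl ne
𝟙-sum (zero ∷ as)  ne = 𝟙-sum as ne
𝟙-sum (suc a ∷ as) ne = refl

Q⊕Q≈E⊕𝟙 : Q ⊕ Q ≈ E ⊕ 𝟙
Q⊕Q≈E⊕𝟙 as rewrite E≡2^support as | 𝟙-support as with support as
... | zero  = refl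
... | suc k = cong +_ (trans (cong (2 ℕ.^ k ℕ.+_) (sym (ℕ.+-identityʳ (2 ℕ.^ k)))) (sym (ℕ.+-identityʳ _)))

Q≈P⊕𝟙 : Q ≈ P ⊕ 𝟙
Q≈P⊕𝟙 as = lemma (Q as) (𝟙 as)
  where
  lemma : ∀ a b → a ≡ a - b + b
  lemma = solve-∀

E≈P⊕P⊕𝟙 : E ≈ P ⊕ P ⊕ 𝟙
E≈P⊕P⊕𝟙 as = lemma (Q as) (E as) (𝟙 as) (Q⊕Q≈E⊕𝟙 as)
  where
  expand : ∀ a c → a - c + (a - c) + c ≡ a + a - c
  expand = solve-∀
  cancel : ∀ b c → b ≡ b + c - c
  cancel = solve-∀
  lemma : ∀ a b c → a + a ≡ b + c → b ≡ a - c + (a - c) + c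
  lemma a b c eq = trans (cancel b c) (trans (cong (λ t → t - c) (sym eq)) (sym (expand a c)))

alternate-+ : ∀ a b → alternate (a ℕ.+ b) ≡ alternate a * alternate b
alternate-+ zero    b = sym (ℤ.*-identityˡ _)
alternate-+ (suc a) b = trans (cong -_ (alternate-+ a b)) (ℤ.neg-distribˡ-* (alternate a) (alternate b))

alternate-odd : ∀ n → alternate n ≡ (if odd n then - 1ℤ else 1ℤ)
alternate-odd zero          = refl
alternate-odd (suc zero)    = refl
alternate-odd (suc (suc n)) = trans (ℤ.neg-involutive (alternate n)) (alternate-odd n)

E⁻-sum : ∀ as → E⁻ as ≡ alternate (sum as) * E as
E⁻-sum []           = refl
E⁻-sum (zero ∷ as)  = E⁻-sum as
E⁻-sum (suc a ∷ as) = begin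
  + 2 * alternate (suc a) * E⁻ as                              ≡⟨ cong (λ t → + 2 * alternate (suc a) * t) (E⁻-sum as) ⟩
  + 2 * alternate (suc a) * (alternate (sum as) * E as)        ≡⟨ regroup (+ 2) (alternate (suc a)) (alternate (sum as)) (E as) ⟩
  alternate (suc a) * alternate (sum as) * (+ 2 * E as)        ≡⟨ cong (λ t → t * (+ 2 * E as)) (alternate-+ (suc a) (sum as)) ⟨
  alternate (suc a ℕ.+ sum as) * (+ 2 * E as)                  ∎
  where
  open ≡-Reasoning
  regroup : ∀ a b c d → a * b * (c * d) ≡ b * c * (a * d)
  regroup = solve-∀

-- E - E⁻ is twice the odd part of E, and E agrees with 2Q outside the constant term, which has even
-- degree. The additive form suits `seriesSemiring`, where the solver knows no subtraction.
4F⊕E⁻≈E : F ⊕ F ⊕ (F ⊕ F) ⊕ E⁻ ≈ E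
4F⊕E⁻≈E as rewrite E⁻-sum as | alternate-odd (sum as) with odd (sum as) in parity
... | false = trans (ℤ.+-identityˡ _) (ℤ.*-identityˡ (E as))
... | true  = trans (cong₂ _+_ (cong₂ _+_ 2Q≡E 2Q≡E) (sym (ℤ.neg-distribˡ-* 1ℤ (E as)))) (lemma (E as))
  where
  2Q≡E : Q as + Q as ≡ E as
  2Q≡E = trans (Q⊕Q≈E⊕𝟙 as) (trans (+-congˡ (E as) (𝟙-sum as λ s≡0 → contradiction (trans (sym parity) (cong odd s≡0)) λ ()))
    (ℤ.+-identityʳ (E as)))
  lemma : ∀ e → e + e + - (1ℤ * e) ≡ e
  lemma = solve-∀

⊛-scalarʳ : ∀ c f g → f ⊛ (λ v → c * g v) ≈ (λ v → c * (f ⊛ g) v)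
⊛-scalarʳ c f g []           = swap-* (f []) c (g [])
  where
  swap-* : ∀ a b d → a * (b * d) ≡ b * (a * d)
  swap-* = solve-∀
⊛-scalarʳ c f g (zero ∷ as)  = ⊛-scalarʳ c (coeff 0 f) (coeff 0 g) as
⊛-scalarʳ c f g (suc a ∷ as) = trans
  (cong₂ _+_ (⊛-scalarʳ c (coeff 0 f) (coeff (suc a) g) as) (⊛-scalarʳ c (tail f) g (a ∷ as)))
  (sym (ℤ.*-distribˡ-+ c ((coeff 0 f ⊛ coeff (suc a) g) as) _))

⊛-scalarˡ : ∀ c f g → (λ v → c * f v) ⊛ g ≈ (λ v → c * (f ⊛ g) v)
⊛-scalarˡ c f g as = trans (⊛-comm (λ v → c * f v) g as)
  (trans (⊛-scalarʳ c g f as) (cong (λ t → c * t) (⊛-comm g f as)))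

mutual
  E⊛E⁻≈𝟙 : E ⊛ E⁻ ≈ 𝟙
  E⊛E⁻≈𝟙 []           = refl
  E⊛E⁻≈𝟙 (zero ∷ as)  = E⊛E⁻≈𝟙 as
  E⊛E⁻≈𝟙 (suc a ∷ as) = trans
    (cong₂ _+_ (trans (⊛-scalarʳ (+ 2 * - alternate a) E E⁻ as) (cong (λ t → + 2 * - alternate a * t) (E⊛E⁻≈𝟙 as)))
               (tail-E⊛E⁻ a as))
    (lemma (alternate a) (𝟙 as))
    where
    lemma : ∀ s d → + 2 * - s * d + + 2 * s * d ≡ 0ℤ
    lemma = solve-∀

  -- In the first variable x, `tail E` is 2/(1-x) and E⁻ is (1-x)/(1+x), with product 2/(1+x); in
  -- the other variables E and E⁻ cancel.
  tail-E⊛E⁻ : ∀ a as → (tail E ⊛ E⁻) (a ∷ as) ≡ + 2 * alternate a * 𝟙 as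
  tail-E⊛E⁻ zero    as = trans (⊛-scalarˡ (+ 2) E E⁻ as) (cong (λ t → + 2 * t) (E⊛E⁻≈𝟙 as))
  tail-E⊛E⁻ (suc a) as = trans
    (cong₂ _+_
      (trans (⊛-scalarˡ (+ 2) E (λ v → + 2 * - alternate a * E⁻ v) as)
             (cong (λ t → + 2 * t) (trans (⊛-scalarʳ (+ 2 * - alternate a) E E⁻ as) (cong (λ t → + 2 * - alternate a * t) (E⊛E⁻≈𝟙 as)))))
      (trans (⊛-cong {g = E⁻} (λ { [] → refl ; (_ ∷ _) → refl }) (λ _ → refl) (a ∷ as)) (tail-E⊛E⁻ a as)))
    (lemma (alternate a) (𝟙 as))
    where
    lemma : ∀ s d → + 2 * (+ 2 * - s * d) + + 2 * s * d ≡ + 2 * - s * d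
    lemma = solve-∀

-- This is F = u/(1-u²) without denominators, since u/(1-u²) = PQ/(Q²-P²) and Q²-P² = P+Q = E. Four
-- times either side plus 1 is E²: on the left by 4F = E - E⁻ and E · E⁻ = 1, on the right by E =
-- 2P+1.
F⊛E≈P⊛Q : F ⊛ E ≈ P ⊛ Q
F⊛E≈P⊛Q as = ×4-cancel (∙-cancelʳ (𝟙 as) _ _ (quadruple as))
  where
  open SetoidReasoning ≈-setoid
  quadruple : F ⊛ E ⊕ F ⊛ E ⊕ (F ⊛ E ⊕ F ⊛ E) ⊕ 𝟙 ≈ P ⊛ Q ⊕ P ⊛ Q ⊕ (P ⊛ Q ⊕ P ⊛ Q) ⊕ 𝟙
  quadruple = begin
    F ⊛ E ⊕ F ⊛ E ⊕ (F ⊛ E ⊕ F ⊛ E) ⊕ 𝟙         ≈⟨ ⊕-cong {F ⊛ E ⊕ F ⊛ E ⊕ (F ⊛ E ⊕ F ⊛ E)} ≈-refl (≈-sym E⊛E⁻≈𝟙) ⟩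
    F ⊛ E ⊕ F ⊛ E ⊕ (F ⊛ E ⊕ F ⊛ E) ⊕ E ⊛ E⁻    ≈⟨ Series.solve 3 (λ f e e⁻ → f :* e :+ f :* e :+ (f :* e :+ f :* e) :+ e :* e⁻ := e :* (f :+ f :+ (f :+ f) :+ e⁻)) ≈-refl F E E⁻ ⟩
    E ⊛ (F ⊕ F ⊕ (F ⊕ F) ⊕ E⁻)                   ≈⟨ ⊛-cong E≈P⊕P⊕𝟙 (≈-trans 4F⊕E⁻≈E E≈P⊕P⊕𝟙) ⟩
    (P ⊕ P ⊕ 𝟙) ⊛ (P ⊕ P ⊕ 𝟙)                    ≈⟨ Series.solve 1 (λ p → (p :+ p :+ con 1) :* (p :+ p :+ con 1) := p :* (p :+ con 1) :+ p :* (p :+ con 1) :+ (p :* (p :+ con 1) :+ p :* (p :+ con 1)) :+ con 1) ≈-refl P ⟩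
    P ⊛ (P ⊕ 𝟙) ⊕ P ⊛ (P ⊕ 𝟙) ⊕ (P ⊛ (P ⊕ 𝟙) ⊕ P ⊛ (P ⊕ 𝟙)) ⊕ 𝟙
      ≈⟨ ⊕-cong (⊕-cong (⊕-cong PQ PQ) (⊕-cong PQ PQ)) ≈-refl ⟩
    P ⊛ Q ⊕ P ⊛ Q ⊕ (P ⊛ Q ⊕ P ⊛ Q) ⊕ 𝟙          ∎
    where
    open Series using (_:*_; _:+_; _:=_; con)
    PQ : P ⊛ (P ⊕ 𝟙) ≈ P ⊛ Q
    PQ = ⊛-cong {P} ≈-refl (≈-sym Q≈P⊕𝟙)
  ×4-cancel : ∀ {x y} → x + x + (x + x) ≡ y + y + (y + y) → x ≡ y
  ×4-cancel {x} {y} eq = ℤ.*-cancelˡ-≡ (+ 4) x y (trans (×4 x) (trans eq (sym (×4 y))))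
    where
    ×4 : ∀ z → + 4 * z ≡ z + z + (z + z)
    ×4 = solve-∀

-- Composition with F after clearing denominators

Qpow : ℕ → Series
Qpow zero    = 𝟙
Qpow (suc n) = Q ⊛ Qpow n

-- homogeneous n s = Σ_{j<n} s j · P^j · Q^(n-j): the truncation of Σ_j s j · u^j, where u = P/Q,
-- with the denominators cleared.
homogeneous : ℕ → (ℕ → ℤ) → Series
homogeneous zero    s = 𝟘
homogeneous (suc n) s = constant (s 0) ⊛ Qpow (suc n) ⊕ P ⊛ homogeneous n (shift s)

-- compose n s = Σ_{ℓ<n} s ℓ · F^ℓ
compose : ℕ → (ℕ → ℤ) → Series
compose zero    s = 𝟘
compose (suc n) s = constant (s 0) ⊕ F ⊛ compose n (shift s)

constant-+ : ∀ a b → constant (a + b) ≈ constant a ⊕ constant b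
constant-+ a b as = ℤ.*-distribʳ-+ (𝟙 as) a b

constant-0 : constant 0ℤ ≈ 𝟘
constant-0 as = ℤ.*-zeroˡ (𝟙 as)

constant-1 : constant 1ℤ ≈ 𝟙
constant-1 as = ℤ.*-identityˡ (𝟙 as)

sum≡0⇒support≡0 : ∀ as → sum as ≡ 0 → support as ≡ 0
sum≡0⇒support≡0 []          s = refl
sum≡0⇒support≡0 (zero ∷ as) s = sum≡0⇒support≡0 as s

P-order : P ≈[ 1 ] 𝟘
P-order as (s≤s s≤0) rewrite 𝟙-support as | sum≡0⇒support≡0 as (ℕ.n≤0⇒n≡0 s≤0) = refl

F-order : F ≈[ 1 ] 𝟘
F-order as (s≤s s≤0) = cong (λ k → if odd k then Q as else 0ℤ) (ℕ.n≤0⇒n≡0 s≤0)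

homogeneous-+ : ∀ n s t → homogeneous n (λ j → s j + t j) ≈ homogeneous n s ⊕ homogeneous n t
homogeneous-+ zero    s t = λ _ → refl
homogeneous-+ (suc n) s t = begin
  constant (s 0 + t 0) ⊛ Qpow (suc n) ⊕ P ⊛ homogeneous n (λ j → shift s j + shift t j)
    ≈⟨ ⊕-cong (⊛-cong {g = Qpow (suc n)} (constant-+ (s 0) (t 0)) ≈-refl) (⊛-cong {P} ≈-refl (homogeneous-+ n (shift s) (shift t))) ⟩
  (constant (s 0) ⊕ constant (t 0)) ⊛ Qpow (suc n) ⊕ P ⊛ (homogeneous n (shift s) ⊕ homogeneous n (shift t))
    ≈⟨ Series.solve 6 (λ a b q p x y → (a :+ b) :* q :+ p :* (x :+ y) := (a :* q :+ p :* x) :+ (b :* q :+ p :* y)) ≈-refl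
         (constant (s 0)) (constant (t 0)) (Qpow (suc n)) P (homogeneous n (shift s)) (homogeneous n (shift t)) ⟩
  homogeneous (suc n) s ⊕ homogeneous (suc n) t ∎
  where
  open SetoidReasoning ≈-setoid
  open Series using (_:*_; _:+_; _:=_; con)

-- The one additional summand is s n · P^n · Q, which has no terms of degree below n.
homogeneous-suc : ∀ n s → homogeneous (suc n) s ≈[ n ] Q ⊛ homogeneous n s
homogeneous-suc zero    s = λ _ ()
homogeneous-suc (suc n) s = begin
  constant (s 0) ⊛ (Q ⊛ Qpow (suc n)) ⊕ P ⊛ homogeneous (suc n) (shift s)
    ≈⟨ ⊕-cong[] {f = constant (s 0) ⊛ (Q ⊛ Qpow (suc n))} ⌊ ≈-refl ⌋ (⊛-raise P-order (homogeneous-suc n (shift s))) ⟩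
  constant (s 0) ⊛ (Q ⊛ Qpow (suc n)) ⊕ P ⊛ (Q ⊛ homogeneous n (shift s))
    ≈⟨ ⌊ Series.solve 5 (λ c q q′ p x → c :* (q :* q′) :+ p :* (q :* x) := q :* (c :* q′ :+ p :* x)) ≈-refl
          (constant (s 0)) Q (Qpow (suc n)) P (homogeneous n (shift s)) ⌋ ⟩
  Q ⊛ homogeneous (suc n) s ∎
  where
  open SetoidReasoning ≈[ suc n ]-setoid
  open Series using (_:*_; _:+_; _:=_; con)

homogeneous-shift : ∀ n s → s 0 ≡ 0ℤ → homogeneous (suc n) s ≈ P ⊛ homogeneous n (shift s)
homogeneous-shift n s s0≡0 as = trans
  (cong (λ t → t + (P ⊛ homogeneous n (shift s)) as)
    (trans (⊛-cong {g = Qpow (suc n)} (λ bs → trans (cong (λ c → constant c bs) s0≡0) (constant-0 bs)) ≈-refl as) (⊛-zeroˡ (Qpow (suc n)) as)))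
  (ℤ.+-identityˡ _)

-- The recursion of oddSplitSum says that with u = P/Q the series Σ_j oddSplitSum m j u^j, minus its
-- constant term, is u/(1-u²) times Σ_j oddSplitSum (shift m) j u^j; here E = Q² - P².
homogeneous-oddSplitSum : ∀ n m →
  E ⊛ homogeneous n (shift (oddSplitSum m)) ≈[ n ] Q ⊛ (Q ⊛ homogeneous n (oddSplitSum (shift m)))
-- Adding P²S to both sides completes E = Q² - P² to Q².
homogeneous-oddSplitSum n m = ⊕-cancelʳ[] (P ⊛ (P ⊛ S)) (begin
  E ⊛ S ⊕ P ⊛ (P ⊛ S)          ≈⟨ ⌊ ⊕-cong (⊛-cong {g = S} E≈P⊕P⊕𝟙 ≈-refl) (≈-refl {P ⊛ (P ⊛ S)}) ⌋ ⟩
  (P ⊕ P ⊕ 𝟙) ⊛ S ⊕ P ⊛ (P ⊛ S)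
    ≈⟨ ⌊ Series.solve 2 (λ p b → (p :+ p :+ con 1) :* b :+ p :* (p :* b) := (p :+ con 1) :* ((p :+ con 1) :* b)) ≈-refl P S ⌋ ⟩
  (P ⊕ 𝟙) ⊛ ((P ⊕ 𝟙) ⊛ S)      ≈⟨ ⌊ ⊛-cong (≈-sym Q≈P⊕𝟙) (⊛-cong {g = S} (≈-sym Q≈P⊕𝟙) ≈-refl) ⌋ ⟩
  Q ⊛ (Q ⊛ S)                  ≈⟨ ⌊ ⊛-cong {Q} ≈-refl (⊛-cong {Q} ≈-refl (homogeneous-+ n (evenHeadSum m) (oddSplitSum (shift m)))) ⌋ ⟩
  Q ⊛ (Q ⊛ (V ⊕ R))            ≈⟨ ⌊ Series.solve 3 (λ q c a → q :* (q :* (c :+ a)) := q :* (q :* a) :+ q :* (q :* c)) ≈-refl Q V R ⌋ ⟩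
  Q ⊛ (Q ⊛ R) ⊕ Q ⊛ (Q ⊛ V)    ≈⟨ ⊕-cong[] {f = Q ⊛ (Q ⊛ R)} ⌊ ≈-refl ⌋ evenHead ⟩
  Q ⊛ (Q ⊛ R) ⊕ P ⊛ (P ⊛ S)    ∎)
  where
  open SetoidReasoning ≈[ n ]-setoid
  open Series using (_:*_; _:+_; _:=_; con)
  R = homogeneous n (oddSplitSum (shift m))
  S = homogeneous n (shift (oddSplitSum m))
  V = homogeneous n (evenHeadSum m)
  -- The first two values of `evenHeadSum m` are 0 and dropping them leaves `shift (oddSplitSum m)`,
  -- so as series in u, V is u² S.
  evenHead : Q ⊛ (Q ⊛ V) ≈[ n ] P ⊛ (P ⊛ S)
  evenHead = begin
    Q ⊛ (Q ⊛ V)                                       ≈⟨ ⊛-congˡ[] Q (homogeneous-suc n (evenHeadSum m)) ⟨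
    Q ⊛ homogeneous (suc n) (evenHeadSum m)           ≈⟨ weaken (homogeneous-suc (suc n) (evenHeadSum m)) ⟨
    homogeneous (suc (suc n)) (evenHeadSum m)         ≈⟨ ⌊ homogeneous-shift (suc n) (evenHeadSum m) refl ⌋ ⟩
    P ⊛ homogeneous (suc n) (shift (evenHeadSum m))   ≈⟨ ⌊ ⊛-cong {P} ≈-refl (homogeneous-shift n (shift (evenHeadSum m)) refl) ⌋ ⟩
    P ⊛ (P ⊛ S)                                       ∎

-- As F = u/(1-u²), the coefficient of u^j in F^ℓ counts the splits of j items into ℓ odd groups.
-- Expanding the sum of m ℓ · F^ℓ in powers of u thus gives `oddSplitSum m j` at u^j, and Q^n clears
-- the denominators.
compose-homogeneous : ∀ n m → Qpow n ⊛ compose n m ≈[ n ] homogeneous n (oddSplitSum m)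
compose-homogeneous zero    m = λ _ ()
compose-homogeneous (suc n) m = begin
  Q ⊛ Qpow n ⊛ (constant (m 0) ⊕ F ⊛ compose n (shift m))
    ≈⟨ ⌊ Series.solve 5 (λ q q′ c f t → q :* q′ :* (c :+ f :* t) := c :* (q :* q′) :+ f :* (q :* (q′ :* t))) ≈-refl
          Q (Qpow n) (constant (m 0)) F (compose n (shift m)) ⌋ ⟩
  constant (m 0) ⊛ Qpow (suc n) ⊕ F ⊛ (Q ⊛ (Qpow n ⊛ compose n (shift m)))
    ≈⟨ ⊕-cong[] {f = constant (m 0) ⊛ Qpow (suc n)} ⌊ ≈-refl ⌋ (⊛-raise F-order (⊛-congˡ[] Q (compose-homogeneous n (shift m)))) ⟩
  constant (m 0) ⊛ Qpow (suc n) ⊕ F ⊛ (Q ⊛ R)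
    ≈⟨ ⊕-cong[] {f = constant (m 0) ⊛ Qpow (suc n)} ⌊ ≈-refl ⌋ step ⟩
  constant (m 0) ⊛ Qpow (suc n) ⊕ P ⊛ S ∎
  where
  open SetoidReasoning ≈[ suc n ]-setoid
  open Series using (_:*_; _:+_; _:=_; con)
  R = homogeneous n (oddSplitSum (shift m))
  S = homogeneous n (shift (oddSplitSum m))
  cancelE : ∀ Y → E⁻ ⊛ (E ⊛ Y) ≈ Y
  cancelE Y = ≈-trans (≈-sym (⊛-assoc E⁻ E Y))
    (≈-trans (⊛-cong {g = Y} (≈-trans (⊛-comm E⁻ E) E⊛E⁻≈𝟙) ≈-refl) (⊛-identityˡ Y))
  -- Multiplying by E turns F into PQ and makes `homogeneous-oddSplitSum` applicable, whose
  -- precision n the factor P raises to n+1. Multiplying by E⁻ undoes this.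
  step : F ⊛ (Q ⊛ R) ≈[ suc n ] P ⊛ S
  step = begin
    F ⊛ (Q ⊛ R)                ≈⟨ ⌊ cancelE (F ⊛ (Q ⊛ R)) ⌋ ⟨
    E⁻ ⊛ (E ⊛ (F ⊛ (Q ⊛ R)))   ≈⟨ ⌊ Series.solve 5 (λ e e⁻ f q a → e⁻ :* (e :* (f :* (q :* a))) := e⁻ :* (f :* e :* (q :* a))) ≈-refl E E⁻ F Q R ⌋ ⟩
    E⁻ ⊛ (F ⊛ E ⊛ (Q ⊛ R))     ≈⟨ ⌊ ⊛-cong {E⁻} ≈-refl (⊛-cong {g = Q ⊛ R} F⊛E≈P⊛Q ≈-refl) ⌋ ⟩
    E⁻ ⊛ (P ⊛ Q ⊛ (Q ⊛ R))     ≈⟨ ⌊ ⊛-cong {E⁻} ≈-refl (⊛-assoc P Q (Q ⊛ R)) ⌋ ⟩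
    E⁻ ⊛ (P ⊛ (Q ⊛ (Q ⊛ R)))   ≈⟨ ⊛-congˡ[] E⁻ (⊛-raise P-order (homogeneous-oddSplitSum n m)) ⟨
    E⁻ ⊛ (P ⊛ (E ⊛ S))         ≈⟨ ⌊ Series.solve 4 (λ e e⁻ p b → e⁻ :* (p :* (e :* b)) := e⁻ :* (e :* (p :* b))) ≈-refl E E⁻ P S ⌋ ⟩
    E⁻ ⊛ (E ⊛ (P ⊛ S))         ≈⟨ ⌊ cancelE (P ⊛ S) ⌋ ⟩
    P ⊛ S                      ∎

-- The geometric series 1/(1-u) = Q: because Q - P = 1, the sum of P^j · Q^(n-j) over j < n is
-- Q^(n+1) - P^n · Q.
homogeneous-1 : ∀ n s → (∀ j → s j ≡ 1ℤ) → homogeneous n s ≈[ n ] Qpow (suc n)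
homogeneous-1 zero    s s≡1 = λ _ ()
homogeneous-1 (suc n) s s≡1 = begin
  constant (s 0) ⊛ Qpow (suc n) ⊕ P ⊛ homogeneous n (shift s)
    ≈⟨ ⊕-cong[] ⌊ ⊛-cong {g = Qpow (suc n)} (λ as → trans (cong (λ c → constant c as) (s≡1 0)) (constant-1 as)) ≈-refl ⌋
                (⊛-raise P-order (homogeneous-1 n (shift s) (s≡1 ∘ suc))) ⟩
  𝟙 ⊛ Qpow (suc n) ⊕ P ⊛ Qpow (suc n)
    ≈⟨ ⌊ Series.solve 2 (λ p q → con 1 :* q :+ p :* q := (p :+ con 1) :* q) ≈-refl P (Qpow (suc n)) ⌋ ⟩
  (P ⊕ 𝟙) ⊛ Qpow (suc n)
    ≈⟨ ⌊ ⊛-cong {g = Qpow (suc n)} (≈-sym Q≈P⊕𝟙) ≈-refl ⌋ ⟩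
  Qpow (suc (suc n)) ∎
  where
  open SetoidReasoning ≈[ suc n ]-setoid
  open Series using (_:*_; _:+_; _:=_; con)

-- Q has constant term 1, so it may be cancelled degree by degree.
Q-cancel : ∀ {n f g} → Q ⊛ f ≈[ n ] Q ⊛ g → f ≈[ n ] g
Q-cancel {zero}  _  = λ _ ()
Q-cancel {suc n} {f} {g} eq = ⊕-cancelʳ[] (P ⊛ g) (begin
  f ⊕ P ⊛ g          ≈⟨ ⊕-cong[] {f = f} ⌊ ≈-refl ⌋ (⊛-raise P-order (Q-cancel (weaken eq))) ⟨
  f ⊕ P ⊛ f          ≈⟨ ⌊ unfold f ⌋ ⟨
  Q ⊛ f              ≈⟨ eq ⟩
  Q ⊛ g              ≈⟨ ⌊ unfold g ⌋ ⟩
  g ⊕ P ⊛ g          ∎)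
  where
  open SetoidReasoning ≈[ suc n ]-setoid
  open Series using (_:*_; _:+_; _:=_; con)
  unfold : ∀ h → Q ⊛ h ≈ h ⊕ P ⊛ h
  unfold h = ≈-trans (⊛-cong {g = h} Q≈P⊕𝟙 ≈-refl) (Series.solve 2 (λ p x → (p :+ con 1) :* x := x :+ p :* x) ≈-refl P h)

Qpow-cancel : ∀ k {n f g} → Qpow k ⊛ f ≈[ n ] Qpow k ⊛ g → f ≈[ n ] g
Qpow-cancel zero    {n} {f} {g} eq as lt = trans (sym (⊛-identityˡ f as)) (trans (eq as lt) (⊛-identityˡ g as))
Qpow-cancel (suc k) {n} {f} {g} eq = Qpow-cancel k (Q-cancel λ as lt →
  trans (sym (⊛-assoc Q (Qpow k) f as)) (trans (eq as lt) (⊛-assoc Q (Qpow k) g as)))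

compose-μ : ∀ n → compose n μ ≈[ n ] Q
compose-μ n = Qpow-cancel n (begin
  Qpow n ⊛ compose n μ            ≈⟨ compose-homogeneous n μ ⟩
  homogeneous n (oddSplitSum μ)   ≈⟨ homogeneous-1 n (oddSplitSum μ) oddSplitSum-μ ⟩
  Q ⊛ Qpow n                      ≈⟨ ⌊ ⊛-comm Q (Qpow n) ⌋ ⟩
  Qpow n ⊛ Q                      ∎)
  where open SetoidReasoning ≈[ n ]-setoid

-- Cutting tuples of words

infixr 5 _∷_

-- Glue ps rs gs: cutting each group of gs in two gives the prefixes ps and the remainders rs.
data Glue {A : Set} : (ps rs gs : List (List A)) → Set where
  []  : Glue [] [] []
  _∷_ : ∀ {p r g ps rs gs} → p ++ r ≡ g → Glue ps rs gs → Glue (p ∷ ps) (r ∷ rs) (g ∷ gs)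

cuts : List A → List (List A × List A)
cuts []      = [ [] , [] ]
cuts (x ∷ g) = ([] , x ∷ g) ∷ map (λ (p , r) → x ∷ p , r) (cuts g)

prefixes : List (List A) → List (List (List A) × List (List A))
prefixes []       = [ [] , [] ]
prefixes (g ∷ gs) = concatMap (λ (p , r) → map (λ (ps , rs) → p ∷ ps , r ∷ rs) (prefixes gs)) (cuts g)

lengths : List (List A) → List ℕ
lengths = map length

-- A word of length a has exactly one cut for each way to write a as an ordered sum of two
-- exponents, so cutting a tuple of words is the Cauchy product in combinatorial form.
∑-prefixes : (gs : List (List A)) (f h : Series) →
  ∑ (prefixes gs) (λ (ps , rs) → f (lengths ps) * h (lengths rs)) ≡ (f ⊛ h) (lengths gs)
∑-prefixes []       f h = ℤ.+-identityʳ _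
∑-prefixes (g ∷ gs) f h = trans (∑-concatMap _ (cuts g))
  (trans (∑-cong (cuts g) λ {(p , r)} _ → trans (∑-map _ (prefixes gs)) (∑-prefixes gs (coeff (length p) f) (coeff (length r) h)))
         (∑-cuts g f))
  where
  ∑-cuts : ∀ g f → ∑ (cuts g) (λ (p , r) → (coeff (length p) f ⊛ coeff (length r) h) (lengths gs)) ≡ (f ⊛ h) (length g ∷ lengths gs)
  ∑-cuts []      f = ℤ.+-identityʳ _
  ∑-cuts (x ∷ g) f = +-congˡ ((coeff 0 f ⊛ coeff (suc (length g)) h) (lengths gs)) (trans (∑-map _ (cuts g)) (∑-cuts g (tail f)))

∈-cuts⁺ : (p : List A) {r : List A} → (p , r) ∈ cuts (p ++ r)
∈-cuts⁺ []      {[]}    = here refl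
∈-cuts⁺ []      {x ∷ r} = here refl
∈-cuts⁺ (x ∷ p)         = there (∈-map⁺ _ (∈-cuts⁺ p))

∈-cuts⁻ : (g : List A) {p r : List A} → (p , r) ∈ cuts g → p ++ r ≡ g
∈-cuts⁻ []      (here refl) = refl
∈-cuts⁻ (x ∷ g) (here refl) = refl
∈-cuts⁻ (x ∷ g) (there pr∈) with _ , pr∈′ , refl ← ∈-map⁻ _ pr∈ = cong (x ∷_) (∈-cuts⁻ g pr∈′)

cuts-unique : (g : List A) → Unique (cuts g)
cuts-unique []      = [] ∷ []
cuts-unique (x ∷ g) =
  All.tabulate (λ z∈ → λ { refl → case ∈-map⁻ _ z∈ of λ { (_ , _ , ()) } })
  ∷ Unique.map⁺ (λ { {_ , _} {_ , _} refl → refl }) (cuts-unique g)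

∈-prefixes⁺ : {ps rs gs : List (List A)} → Glue ps rs gs → (ps , rs) ∈ prefixes gs
∈-prefixes⁺ []                     = here refl
∈-prefixes⁺ (_∷_ {p} {r} refl glue) = ∈-concatMap⁺ _ (lose (∈-cuts⁺ p) (∈-map⁺ _ (∈-prefixes⁺ glue)))

∈-prefixes⁻ : (gs : List (List A)) {ps rs : List (List A)} → (ps , rs) ∈ prefixes gs → Glue ps rs gs
∈-prefixes⁻ []       (here refl) = []
∈-prefixes⁻ (g ∷ gs) z∈
  with (p , r) , pr∈ , z∈′ ← find (∈-concatMap⁻ (λ (p , r) → map (λ (ps , rs) → p ∷ ps , r ∷ rs) (prefixes gs)) {cuts g} z∈)
  with _ , psrs∈ , refl ← ∈-map⁻ _ z∈′ = ∈-cuts⁻ g pr∈ ∷ ∈-prefixes⁻ gs psrs∈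

prefixes-unique : (gs : List (List A)) → Unique (prefixes gs)
prefixes-unique []       = [] ∷ []
prefixes-unique (g ∷ gs) = concatMap-unique (cuts-unique g)
  (λ _ → Unique.map⁺ (λ { {_ , _} {_ , _} refl → refl }) (prefixes-unique gs))
  (λ { {_ , _} {_ , _} _ _ z∈ z∈′ → case (∈-map⁻ _ z∈ , ∈-map⁻ _ z∈′) of λ { ((_ , _ , refl) , (_ , _ , refl)) → refl } })

Glue-functional : {ps rs rs′ gs : List (List A)} → Glue ps rs gs → Glue ps rs′ gs → rs ≡ rs′
Glue-functional []                 []            = refl
Glue-functional (_∷_ {p} refl glue) (eq ∷ glue′) = cong₂ _∷_ (sym (++-cancelˡ p _ _ eq)) (Glue-functional glue glue′)

Glue-sum : {ps rs gs : List (List A)} → Glue ps rs gs → sum (lengths ps) ℕ.+ sum (lengths rs) ≡ sum (lengths gs)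
Glue-sum []                      = refl
Glue-sum (_∷_ {p} {r} refl glue) = trans (ℕ-interchange (length p) _ (length r) _)
  (cong₂ ℕ._+_ (sym (length-++ p)) (Glue-sum glue))

-- A sequence of tuples of words whose columns concatenate to the groups of gs.
data Columns {A : Set} : List (List A) → List (List (List A)) → Set where
  []  : ∀ {gs} → All (_≡ []) gs → Columns gs []
  _∷_ : ∀ {ps rs gs pss} → Glue ps rs gs → Columns rs pss → Columns gs (ps ∷ pss)

-- Enumeration of sequences of odd tuples

OddTuple : List (List A) → Set
OddTuple ps = IsOdd (sum (lengths ps))

exhausted : List (List A) → List (List (List (List A)))
exhausted []             = [ [] ]
exhausted ([] ∷ gs)      = exhausted gs
exhausted ((_ ∷ _) ∷ gs) = []

oddPrefixes : List (List A) → List (List (List A) × List (List A))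
oddPrefixes gs = filter (λ (ps , _) → isOdd? (sum (lengths ps))) (prefixes gs)

-- An odd tuple removes at least one letter, so fuel above the total length is enough. The same
-- number truncates `compose`, which keeps the two recursions in step.
oddColumns : ℕ → List (List A) → List (List (List (List A)))
oddColumns zero    gs = []
oddColumns (suc n) gs = exhausted gs ++ concatMap (λ (ps , rs) → map (ps ∷_) (oddColumns n rs)) (oddPrefixes gs)

∈-exhausted⁻ : (gs : List (List A)) {pss : List (List (List A))} → pss ∈ exhausted gs → pss ≡ [] × All (_≡ []) gs
∈-exhausted⁻ []        (here refl) = refl , []
∈-exhausted⁻ ([] ∷ gs) pss∈ with eq , empty ← ∈-exhausted⁻ gs pss∈ = eq , refl ∷ empty

∈-exhausted⁺ : {gs : List (List A)} → All (_≡ []) gs → [] ∈ exhausted gs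
∈-exhausted⁺ []             = here refl
∈-exhausted⁺ (refl ∷ empty) = ∈-exhausted⁺ empty

exhausted-unique : (gs : List (List A)) → Unique (exhausted gs)
exhausted-unique []             = [] ∷ []
exhausted-unique ([] ∷ gs)      = exhausted-unique gs
exhausted-unique ((_ ∷ _) ∷ gs) = []

∈-oddPrefixes⁻ : (gs : List (List A)) {ps rs : List (List A)} → (ps , rs) ∈ oddPrefixes gs → Glue ps rs gs × OddTuple ps
∈-oddPrefixes⁻ gs z∈ with z∈′ , o ← ∈-filter⁻ (λ (ps , _) → isOdd? (sum (lengths ps))) {xs = prefixes gs} z∈ =
  ∈-prefixes⁻ gs z∈′ , o

∈-oddColumns⁻ : ∀ n (gs : List (List A)) {pss} → pss ∈ oddColumns n gs → Columns gs pss × All OddTuple pss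
∈-oddColumns⁻ (suc n) gs pss∈ with ∈-++⁻ (exhausted gs) pss∈
... | inj₁ pss∈ with refl , empty ← ∈-exhausted⁻ gs pss∈ = [] empty , []
... | inj₂ pss∈
  with (ps , rs) , psrs∈ , pss∈ ← find (∈-concatMap⁻ (λ (ps , rs) → map (ps ∷_) (oddColumns n rs)) {oddPrefixes gs} pss∈)
  with _ , pss∈ , refl ← ∈-map⁻ (ps ∷_) pss∈
  with glue , o ← ∈-oddPrefixes⁻ gs psrs∈
  with cols , os ← ∈-oddColumns⁻ n rs pss∈ = glue ∷ cols , o ∷ os

∈-oddColumns⁺ : ∀ n {gs : List (List A)} {pss} → sum (lengths gs) < n → Columns gs pss → All OddTuple pss → pss ∈ oddColumns n gs
∈-oddColumns⁺ (suc n) _         ([] empty) [] = ∈-++⁺ˡ (∈-exhausted⁺ empty)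
∈-oddColumns⁺ (suc n) {gs} (s≤s gs≤n) (_∷_ {ps} {rs} glue cols) (o ∷ os) = ∈-++⁺ʳ (exhausted gs)
  (∈-concatMap⁺ (λ (ps , rs) → map (ps ∷_) (oddColumns n rs)) (lose
    (∈-filter⁺ (λ (ps , _) → isOdd? (sum (lengths ps))) (∈-prefixes⁺ glue) o)
    (∈-map⁺ (ps ∷_) (∈-oddColumns⁺ n rs<n cols os))))
  where
  rs<n : sum (lengths rs) < n
  rs<n = ℕ.<-≤-trans (ℕ.<-≤-trans (ℕ.m<n+m (sum (lengths rs)) (odd⇒positive _ o)) (ℕ.≤-reflexive (Glue-sum glue))) gs≤n

oddColumns-unique : ∀ n (gs : List (List A)) → Unique (oddColumns n gs)
oddColumns-unique zero    gs = []
oddColumns-unique (suc n) gs = Unique.++⁺ (exhausted-unique gs)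
  (concatMap-unique (Unique.filter⁺ _ (prefixes-unique gs))
    (λ {(ps , rs)} _ → Unique.map⁺ ∷-injectiveʳ (oddColumns-unique n rs))
    (λ { {_ , _} {_ , _} psrs∈ psrs∈′ z∈ z∈′ → same psrs∈ psrs∈′ (∈-map⁻ _ z∈) (∈-map⁻ _ z∈′) }))
  λ (z∈ , z∈′) → case ∈-exhausted⁻ gs z∈ of λ { (refl , _) →
    case find (∈-concatMap⁻ (λ (ps , rs) → map (ps ∷_) (oddColumns n rs)) {oddPrefixes gs} z∈′) of λ { ((ps , _) , _ , []∈) →
    case ∈-map⁻ (ps ∷_) []∈ of λ { (_ , _ , ()) } } }
  where
  same : ∀ {ps rs ps′ rs′ z} → (ps , rs) ∈ oddPrefixes gs → (ps′ , rs′) ∈ oddPrefixes gs →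
    (∃ λ pss → pss ∈ oddColumns n rs × z ≡ ps ∷ pss) → (∃ λ pss → pss ∈ oddColumns n rs′ × z ≡ ps′ ∷ pss) →
    (ps , rs) ≡ (ps′ , rs′)
  same psrs∈ psrs∈′ (_ , _ , refl) (_ , _ , refl) =
    cong (_ ,_) (Glue-functional (proj₁ (∈-oddPrefixes⁻ gs psrs∈)) (proj₁ (∈-oddPrefixes⁻ gs psrs∈′)))

columnsWeight : List (List (List A)) → ℤ
columnsWeight []         = 1ℤ
columnsWeight (ps ∷ pss) = Q (lengths ps) * columnsWeight pss

∑-exhausted : (m : ℕ → ℤ) (gs : List (List A)) →
  ∑ (exhausted gs) (λ pss → columnsWeight pss * m (length pss)) ≡ constant (m 0) (lengths gs)
∑-exhausted m []             = trans (ℤ.+-identityʳ _) (ℤ.*-comm 1ℤ (m 0))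
∑-exhausted m ([] ∷ gs)      = ∑-exhausted m gs
∑-exhausted m ((_ ∷ _) ∷ gs) = sym (ℤ.*-zeroʳ (m 0))

-- Stopping gives the constant term m 0. Otherwise the weight of the first tuple and its parity
-- condition together make the factor F, and one index of m is used up.
∑-oddColumns : ∀ n (m : ℕ → ℤ) (gs : List (List A)) →
  ∑ (oddColumns n gs) (λ pss → columnsWeight pss * m (length pss)) ≡ compose n m (lengths gs)
∑-oddColumns zero    m gs = refl
∑-oddColumns {A} (suc n) m gs = begin
  ∑ (oddColumns (suc n) gs) term
    ≡⟨ ∑-++ (exhausted gs) _ ⟩
  ∑ (exhausted gs) term + ∑ (concatMap (λ (ps , rs) → map (ps ∷_) (oddColumns n rs)) (oddPrefixes gs)) term
    ≡⟨ cong₂ _+_ (∑-exhausted m gs) (∑-concatMap (λ (ps , rs) → map (ps ∷_) (oddColumns n rs)) (oddPrefixes gs)) ⟩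
  constant (m 0) (lengths gs) + ∑ (oddPrefixes gs) (λ (ps , rs) → ∑ (map (ps ∷_) (oddColumns n rs)) term)
    ≡⟨ +-congˡ (constant (m 0) (lengths gs)) (trans (∑-cong (oddPrefixes gs) (λ {(ps , rs)} _ → step ps rs))
         (trans (∑-filter _ (prefixes gs)) (∑-cong (prefixes gs) (λ {(ps , rs)} _ → oddFactor ps rs)))) ⟩
  constant (m 0) (lengths gs) + ∑ (prefixes gs) (λ (ps , rs) → F (lengths ps) * compose n (shift m) (lengths rs))
    ≡⟨ +-congˡ (constant (m 0) (lengths gs)) (∑-prefixes gs F (compose n (shift m))) ⟩
  compose (suc n) m (lengths gs)
    ∎
  where
  open ≡-Reasoning
  term : List (List (List A)) → ℤ
  term pss = columnsWeight pss * m (length pss)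
  step : ∀ ps rs → ∑ (map (ps ∷_) (oddColumns n rs)) term ≡ Q (lengths ps) * compose n (shift m) (lengths rs)
  step ps rs = trans (∑-map (ps ∷_) (oddColumns n rs))
    (trans (∑-cong (oddColumns n rs) (λ {pss} _ → ℤ.*-assoc (Q (lengths ps)) (columnsWeight pss) _))
    (trans (∑-*ˡ (Q (lengths ps)) (oddColumns n rs) _) (cong (λ t → Q (lengths ps) * t) (∑-oddColumns n (shift m) rs))))
  oddFactor : ∀ ps rs → (if odd (sum (lengths ps)) then Q (lengths ps) * compose n (shift m) (lengths rs) else 0ℤ)
    ≡ F (lengths ps) * compose n (shift m) (lengths rs)
  oddFactor ps rs with odd (sum (lengths ps))
  ... | true  = refl
  ... | false = sym (ℤ.*-zeroˡ (compose n (shift m) (lengths rs)))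

totalSupport : List (List (List A)) → ℕ
totalSupport pss = sum (map (support ∘ lengths) pss)

sum-positive⇒support-positive : ∀ as → 0 < sum as → 0 < support as
sum-positive⇒support-positive (zero ∷ as)  lt = sum-positive⇒support-positive as lt
sum-positive⇒support-positive (suc a ∷ as) lt = s≤s z≤n

-- An odd tuple has positive support, so the exponents `support ∸ 1` are true differences and can be
-- added up.
columnsWeight-2^ : {pss : List (List (List A))} → All OddTuple pss →
  length pss ≤ totalSupport pss × columnsWeight pss ≡ + (2 ℕ.^ (totalSupport pss ∸ length pss))
columnsWeight-2^ []                     = z≤n , refl
columnsWeight-2^ {pss = ps ∷ pss} (o ∷ os)
  with le , eq ← columnsWeight-2^ os
  with support (lengths ps) | sum-positive⇒support-positive (lengths ps) (odd⇒positive _ o)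
... | suc k | s≤s _ = s≤s (ℕ.≤-trans le (ℕ.m≤n+m _ k)) , (begin
  + (2 ℕ.^ k) * columnsWeight pss                                        ≡⟨ cong (λ t → + (2 ℕ.^ k) * t) eq ⟩
  + (2 ℕ.^ k) * + (2 ℕ.^ (totalSupport pss ∸ length pss))                ≡⟨ ℤ.pos-* (2 ℕ.^ k) _ ⟨
  + (2 ℕ.^ k ℕ.* 2 ℕ.^ (totalSupport pss ∸ length pss))                  ≡⟨ cong +_ (ℕ.^-distribˡ-+-* 2 k _) ⟨
  + (2 ℕ.^ (k ℕ.+ (totalSupport pss ∸ length pss)))                      ≡⟨ cong (λ e → + (2 ℕ.^ e)) (ℕ.+-∸-assoc k le) ⟨
  + (2 ℕ.^ (k ℕ.+ totalSupport pss ∸ length pss))                        ∎)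
  where open ≡-Reasoning

-- Set compositions

AllPairs-++⁻ : {R : A → A → Set} (xs : List A) {ys : List A} → AllPairs R (xs ++ ys) →
  AllPairs R xs × AllPairs R ys × All (λ x → All (R x) ys) xs
AllPairs-++⁻ []       prs        = [] , prs , []
AllPairs-++⁻ (x ∷ xs) (rx ∷ prs) with prs-xs , prs-ys , cross ← AllPairs-++⁻ xs prs =
  All.++⁻ˡ xs rx ∷ prs-xs , prs-ys , All.++⁻ʳ xs rx ∷ cross

tabulate-reindex : ∀ {k m} → k ≡ m → (σ : Permutation k m) (f : Fin m → A) →
  ∃ λ (τ : Permutation′ m) → tabulate (λ i → f (σ ⟨$⟩ʳ i)) ≡ tabulate (λ i → f (τ ⟨$⟩ʳ i))
tabulate-reindex refl σ f = σ , refl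

↭⇒rearrange : (φ ξ : SetComp n) → ξ ↭ φ → ∃ λ (τ : Permutation′ (length φ)) → ξ ≡ rearrange φ τ
↭⇒rearrange φ ξ ξ↭φ with τ , eq ← tabulate-reindex (↭.↭-length ξ↭φ) (onIndices (↭⇒↭ₛ ξ↭φ)) (lookup φ) =
  τ , trans (sym (tabulate-lookup ξ)) (trans (tabulate-cong (↭ₛ.onIndices-lookup (setoid _) (↭⇒↭ₛ ξ↭φ))) eq)

Disjoint : Subset n → Subset n → Set
Disjoint b c = Empty (b ∩ c)

Disjoint-sym : {b c : Subset n} → Disjoint b c → Disjoint c b
Disjoint-sym {b = b} {c} disj (x , x∈) with x∈c , x∈b ← x∈p∩q⁻ c b x∈ = disj (x , x∈p∩q⁺ (x∈b , x∈c))

AllDisjoint-↭ : {bs cs : SetComp n} → bs ↭ cs → AllPairs Disjoint bs → AllPairs Disjoint cs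
AllDisjoint-↭ bs↭cs = ↭ₛ.AllPairs-resp-↭ (setoid _) Disjoint-sym (resp₂ Disjoint) (↭⇒↭ₛ bs↭cs)

Meets : Subset n → Subset n → Set
Meets c b = Nonempty (c ∩ b)

meets? : (c b : Subset n) → Dec (Meets c b)
meets? c b = nonempty? (c ∩ b)

∈-⋃⁺ : {bs : SetComp n} {b : Subset n} {x : Fin n} → b ∈ bs → x ∈ₛ b → x ∈ₛ ⋃ bs
∈-⋃⁺ (here refl) x∈b = x∈p∪q⁺ (inj₁ x∈b)
∈-⋃⁺ (there b∈)  x∈b = x∈p∪q⁺ (inj₂ (∈-⋃⁺ b∈ x∈b))

∈-⋃⁻ : (bs : SetComp n) {x : Fin n} → x ∈ₛ ⋃ bs → ∃ λ b → b ∈ bs × x ∈ₛ b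
∈-⋃⁻ []       x∈ = contradiction x∈ ∉⊥
∈-⋃⁻ (b ∷ bs) x∈ with x∈p∪q⁻ b (⋃ bs) x∈
... | inj₁ x∈b = b , here refl , x∈b
... | inj₂ x∈⋃ with c , c∈ , x∈c ← ∈-⋃⁻ bs x∈⋃ = c , there c∈ , x∈c

⋃-meets : {bs : SetComp n} {b : Subset n} → Nonempty b → b ∈ bs → Meets (⋃ bs) b
⋃-meets (x , x∈b) b∈ = x , x∈p∩q⁺ (∈-⋃⁺ b∈ x∈b , x∈b)

⋃-misses : {bs : SetComp n} {b : Subset n} → (∀ {c} → c ∈ bs → Disjoint c b) → ¬ Meets (⋃ bs) b
⋃-misses {bs = bs} {b} disj (x , x∈) with x∈⋃ , x∈b ← x∈p∩q⁻ (⋃ bs) b x∈ with c , c∈ , x∈c ← ∈-⋃⁻ bs x∈⋃ =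
  disj c∈ (x , x∈p∩q⁺ (x∈c , x∈b))

shared-point : {bs : SetComp n} {b c : Subset n} {x : Fin n} → AllPairs Disjoint bs →
  b ∈ bs → c ∈ bs → x ∈ₛ b → x ∈ₛ c → b ≡ c
shared-point disj        (here refl) (here refl) x∈b x∈c = refl
shared-point (d ∷ disj) (here refl) (there c∈)  x∈b x∈c = contradiction (_ , x∈p∩q⁺ (x∈b , x∈c)) (All.lookup d c∈)
shared-point (d ∷ disj) (there b∈)  (here refl) x∈b x∈c = contradiction (_ , x∈p∩q⁺ (x∈c , x∈b)) (All.lookup d b∈)
shared-point (d ∷ disj) (there b∈)  (there c∈)  x∈b x∈c = shared-point disj b∈ c∈ x∈b x∈c

∣∪∣-disjoint : (p q : Subset n) → Disjoint p q → ∣ p ∪ q ∣ ≡ ∣ p ∣ ℕ.+ ∣ q ∣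
∣∪∣-disjoint Vec.[]             Vec.[]             disj = refl
∣∪∣-disjoint (inside  Vec.∷ p) (inside  Vec.∷ q) disj = contradiction (Fin.zero , Vec.here) disj
∣∪∣-disjoint (inside  Vec.∷ p) (outside Vec.∷ q) disj = cong suc (∣∪∣-disjoint p q (λ (x , x∈) → disj (Fin.suc x , Vec.there x∈)))
∣∪∣-disjoint (outside Vec.∷ p) (inside  Vec.∷ q) disj = trans (cong suc (∣∪∣-disjoint p q (λ (x , x∈) → disj (Fin.suc x , Vec.there x∈)))) (sym (ℕ.+-suc ∣ p ∣ ∣ q ∣))
∣∪∣-disjoint (outside Vec.∷ p) (outside Vec.∷ q) disj = ∣∪∣-disjoint p q (λ (x , x∈) → disj (Fin.suc x , Vec.there x∈))

-- Sizes of disjoint blocks add up, and each odd block changes the parity once. So a union of blocks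
-- of φ is odd exactly if it takes an odd number of them.
odd-⋃ : {bs : SetComp n} → AllPairs Disjoint bs → IsOddSC bs → odd ∣ ⋃ bs ∣ ≡ odd (length bs)
odd-⋃ {n}          []           []       = cong odd (∣⊥∣≡0 n)
odd-⋃ {bs = b ∷ bs} (d ∷ disj) (o ∷ os) = begin
  odd ∣ b ∪ ⋃ bs ∣           ≡⟨ cong odd (∣∪∣-disjoint b (⋃ bs) disjoint) ⟩
  odd (∣ b ∣ ℕ.+ ∣ ⋃ bs ∣)   ≡⟨ odd-+ {∣ b ∣} ∣ ⋃ bs ∣ o ⟩
  not (odd ∣ ⋃ bs ∣)         ≡⟨ cong not (odd-⋃ disj os) ⟩
  not (odd (length bs))      ≡⟨ odd-suc (length bs) ⟨
  odd (suc (length bs))      ∎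
  where
  open ≡-Reasoning
  disjoint : Disjoint b (⋃ bs)
  disjoint (x , x∈) with x∈b , x∈⋃ ← x∈p∩q⁻ b (⋃ bs) x∈ with c , c∈ , x∈c ← ∈-⋃⁻ bs x∈⋃ =
    All.lookup d c∈ (x , x∈p∩q⁺ (x∈b , x∈c))

length-concat : (ps : List (List A)) → length (concat ps) ≡ sum (lengths ps)
length-concat []       = refl
length-concat (p ∷ ps) = trans (length-++ p) (cong (length p ℕ.+_) (length-concat ps))

concat-empty : {gs : List (List A)} → All (_≡ []) gs → concat gs ≡ []
concat-empty []             = refl
concat-empty (refl ∷ empty) = concat-empty empty

Glue-↭ : {ps rs gs : List (List A)} → Glue ps rs gs → concat gs ↭ concat ps ++ concat rs
Glue-↭ []                           = ↭-refl
Glue-↭ (_∷_ {p} {r} {_} {ps} {rs} refl glue) =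
  ↭-trans (↭.++⁺ˡ (p ++ r) (Glue-↭ glue)) (++-interchange p r (concat ps) (concat rs))
  where
  open import Algebra.Properties.CommutativeSemigroup (CommutativeMonoid.commutativeSemigroup ↭.++-commutativeMonoid)
    using () renaming (interchange to ++-interchange)

Columns-↭ : {gs : List (List A)} {pss : List (List (List A))} → Columns gs pss → concat gs ↭ concat (map concat pss)
Columns-↭ ([] empty)                = ↭-reflexive (concat-empty empty)
Columns-↭ (_∷_ {ps} glue cols) = ↭-trans (Glue-↭ glue) (↭.++⁺ˡ (concat ps) (Columns-↭ cols))

filter-Glue : {Q : A → Set} (Q? : Decidable Q) {ps rs gs : List (List A)} →
  All Q (concat ps) → All (¬_ ∘ Q) (concat rs) → Glue ps rs gs → map (filter Q?) gs ≡ ps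
filter-Glue Q? _ _ [] = refl
filter-Glue Q? qs ¬qs (_∷_ {p} {r} refl glue) = cong₂ _∷_
  (trans (filter-++ Q? p r) (trans (cong₂ _++_ (filter-all Q? (All.++⁻ˡ p qs)) (filter-none Q? (All.++⁻ˡ r ¬qs))) (++-identityʳ p)))
  (filter-Glue Q? (All.++⁻ʳ p qs) (All.++⁻ʳ r ¬qs) glue)

filter-Glueʳ : {Q : A → Set} (Q? : Decidable Q) {ps rs gs : List (List A)} →
  All (¬_ ∘ Q) (concat ps) → Glue ps rs gs → map (filter Q?) gs ≡ map (filter Q?) rs
filter-Glueʳ Q? _ [] = refl
filter-Glueʳ Q? ¬qs (_∷_ {p} {r} refl glue) = cong₂ _∷_
  (trans (filter-++ Q? p r) (cong (_++ filter Q? r) (filter-none Q? (All.++⁻ˡ p ¬qs))))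
  (filter-Glueʳ Q? (All.++⁻ʳ p ¬qs) glue)

-- Passing between tuples and set compositions

fromTuples : List (List (List (Subset n))) → SetComp n
fromTuples = map (⋃ ∘ concat)

-- A left inverse of `fromTuples`, which shows that different sequences of tuples give different χ.
-- It also keeps account of ℓ(ψ∧χ), as the nonempty words in the tuple of a block correspond to the
-- blocks of ψ that it meets.
toTuples : List (List (Subset n)) → SetComp n → List (List (List (Subset n)))
toTuples gs = map (λ c → map (filter (meets? c)) gs)

toTuples-fromTuples : {gs : List (List (Subset n))} {pss : List (List (List (Subset n)))} →
  AllPairs Disjoint (concat gs) → All Nonempty (concat gs) → Columns gs pss → toTuples gs (fromTuples pss) ≡ pss
toTuples-fromTuples disj ne ([] _) = refl
toTuples-fromTuples {gs = gs} disj ne (_∷_ {ps} {rs} {_} {pss} glue cols)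
  with disj-ps , disj-rs , cross ← AllPairs-++⁻ (concat ps) (AllDisjoint-↭ (Glue-↭ glue) disj)
  with ne′ ← ↭.All-resp-↭ (Glue-↭ glue) ne = cong₂ _∷_
  (filter-Glue (meets? (⋃ (concat ps)))
    (All.tabulate λ b∈ → ⋃-meets (All.lookup (All.++⁻ˡ (concat ps) ne′) b∈) b∈)
    (All.tabulate λ b∈ → ⋃-misses λ c∈ → All.lookup (All.lookup cross c∈) b∈) glue)
  -- The later blocks of χ miss every block of φ in `ps`, so testing them on the remainders `rs`
  -- gives the same words.
  (trans (map-cong-local (All.tabulate λ c∈ → case ∈-map⁻ (⋃ ∘ concat) c∈ of λ { (ps′ , ps′∈ , refl) →
      filter-Glueʳ (meets? (⋃ (concat ps′)))
        (All.tabulate λ b∈ → ⋃-misses λ c∈ → Disjoint-sym (All.lookup (All.lookup cross b∈)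
          (↭.∈-resp-↭ (↭-sym (Columns-↭ cols)) (∈-concat⁺′ c∈ (∈-map⁺ concat ps′∈))))) glue }))
    (toTuples-fromTuples disj-rs (All.++⁻ʳ (concat ps) ne′) cols))

infix 4 _⊑_

-- The invariant for inductions along `Columns`: a remainder is no longer all of `gs`, but its words
-- still consist of blocks of the right groups, and this suffices for `rows` to sort them back.
_⊑_ : List (List A) → List (List A) → Set
ps ⊑ gs = Pointwise (λ p g → All (_∈ g) p) ps gs

⊑-refl : (gs : List (List A)) → gs ⊑ gs
⊑-refl gs = Pointwise.refl (All.tabulate (λ x∈ → x∈))

⊑-concat : {ps gs : List (List A)} → ps ⊑ gs → ∀ {b} → b ∈ concat ps → b ∈ concat gs
⊑-concat {ps = p ∷ ps} {g ∷ gs} (p⊆g ∷ ps⊑gs) b∈ with ∈-++⁻ p b∈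
... | inj₁ b∈p = ∈-++⁺ˡ (All.lookup p⊆g b∈p)
... | inj₂ b∈  = ∈-++⁺ʳ g (⊑-concat ps⊑gs b∈)

Glue-⊑ : {ps rs ss gs : List (List A)} → Glue ps rs ss → ss ⊑ gs → ps ⊑ gs × rs ⊑ gs
Glue-⊑ []                     []            = [] , []
Glue-⊑ (_∷_ {p} refl glue) (s⊆g ∷ ss⊑gs) with ps⊑ , rs⊑ ← Glue-⊑ glue ss⊑gs =
  All.++⁻ˡ p s⊆g ∷ ps⊑ , All.++⁻ʳ p s⊆g ∷ rs⊑

-- The blocks of ξ lying in the i-th block of map ⋃ gs.
rows : List (List (Subset n)) → SetComp n → List (List (Subset n))
rows gs ξ = map (λ g → filter (meets? (⋃ g)) ξ) gs

rows-concat : {ps gs : List (List (Subset n))} → AllPairs Disjoint (concat gs) → All Nonempty (concat gs) →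
  ps ⊑ gs → rows gs (concat ps) ≡ ps
rows-concat disj ne [] = refl
rows-concat {ps = p ∷ ps} {g ∷ gs} disj ne (p⊆g ∷ ps⊑gs)
  with disj-g , disj-gs , cross ← AllPairs-++⁻ g disj = cong₂ _∷_
  (trans (filter-++ (meets? (⋃ g)) p (concat ps)) (trans (cong₂ _++_
    (filter-all (meets? (⋃ g)) (All.map (λ b∈g → ⋃-meets (All.lookup (All.++⁻ˡ g ne) b∈g) b∈g) p⊆g))
    (filter-none (meets? (⋃ g)) (All.tabulate λ b∈ → ⋃-misses λ c∈g →
      All.lookup (All.lookup cross c∈g) (⊑-concat ps⊑gs b∈))))
    (++-identityʳ p)))
  (trans (map-cong-local (All.tabulate λ {h} h∈ →
      trans (filter-++ (meets? (⋃ h)) p (concat ps)) (cong (_++ filter (meets? (⋃ h)) (concat ps))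
        (filter-none (meets? (⋃ h)) (All.map (λ b∈g → ⋃-misses λ c∈h →
          Disjoint-sym (All.lookup (All.lookup cross b∈g) (∈-concat⁺′ c∈h h∈))) p⊆g)))))
    (rows-concat disj-gs (All.++⁻ʳ g ne) ps⊑gs))

rows-++ : (gs : List (List (Subset n))) (ξ ζ : SetComp n) → Glue (rows gs ξ) (rows gs ζ) (rows gs (ξ ++ ζ))
rows-++ []       ξ ζ = []
rows-++ (g ∷ gs) ξ ζ = sym (filter-++ (meets? (⋃ g)) ξ ζ) ∷ rows-++ gs ξ ζ

Glue-functionalʳ : {ps rs gs gs′ : List (List A)} → Glue ps rs gs → Glue ps rs gs′ → gs ≡ gs′
Glue-functionalʳ []            []              = refl
Glue-functionalʳ (refl ∷ glue) (refl ∷ glue′) = cong (_ ∷_) (Glue-functionalʳ glue glue′)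

rows-[] : {ss gs : List (List (Subset n))} → ss ⊑ gs → All (_≡ []) ss → rows gs [] ≡ ss
rows-[] []         []             = refl
rows-[] (_ ∷ ss⊑) (refl ∷ empty) = cong ([] ∷_) (rows-[] ss⊑ empty)

-- Prefixes are cut from the fronts, so the blocks of each row occur in the concatenation in their
-- original order. For `ss` = `gs` this becomes the condition ψ∧ξ = φ of `InC` by way of `∧SC-rows`.
rows-Columns : {ss gs : List (List (Subset n))} {pss : List (List (List (Subset n)))} →
  AllPairs Disjoint (concat gs) → All Nonempty (concat gs) →
  ss ⊑ gs → Columns ss pss → rows gs (concat (map concat pss)) ≡ ss
rows-Columns disj ne ss⊑gs ([] empty) = rows-[] ss⊑gs empty
rows-Columns {ss = ss} {gs} disj ne ss⊑gs (_∷_ {ps} {rs} {_} {pss} glue cols) with ps⊑gs , rs⊑gs ← Glue-⊑ glue ss⊑gs =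
  Glue-functionalʳ (subst₂ (λ p r → Glue p r (rows gs (concat ps ++ concat (map concat pss))))
    (rows-concat disj ne ps⊑gs) (rows-Columns disj ne rs⊑gs cols) (rows-++ gs (concat ps) (concat (map concat pss)))) glue

rows-splits : (gs : List (List (Subset n))) (hs : List (SetComp n)) → Columns (rows gs (concat hs)) (map (rows gs) hs)
rows-splits gs []       = [] (All.map⁺ (All.tabulate (λ _ → refl)))
rows-splits gs (h ∷ hs) = rows-++ gs h (concat hs) ∷ rows-splits gs hs

⋃-meets⇒⊆ : {bs g : SetComp n} {b : Subset n} → AllPairs Disjoint bs → (∀ {c} → c ∈ g → c ∈ bs) →
  b ∈ bs → Meets (⋃ g) b → b ∈ g
⋃-meets⇒⊆ {g = g} {b} disj g⊆ b∈ (x , x∈)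
  with x∈⋃ , x∈b ← x∈p∩q⁻ (⋃ g) b x∈
  with c , c∈ , x∈c ← ∈-⋃⁻ g x∈⋃
  with refl ← shared-point disj b∈ (g⊆ c∈) x∈b x∈c = c∈

∩-absorbs : {a b : Subset n} → (∀ {x} → x ∈ₛ b → x ∈ₛ a) → a ∩ b ≡ b
∩-absorbs {a = a} {b} b⊆a = ⊆-antisym (λ x∈ → proj₂ (x∈p∩q⁻ a b x∈)) (λ x∈ → x∈p∩q⁺ (b⊆a x∈ , x∈))

-- A block of φ that meets a union of blocks of φ lies inside it, so intersecting with the union
-- amounts to selecting.
filter-∩ : {bs g : SetComp n} → AllPairs Disjoint bs → (∀ {c} → c ∈ g → c ∈ bs) →
  (ξ : SetComp n) → (∀ {b} → b ∈ ξ → b ∈ bs) → filter nonempty? (map (⋃ g ∩_) ξ) ≡ filter (meets? (⋃ g)) ξ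
filter-∩ disj g⊆ []      ξ⊆ = refl
filter-∩ {g = g} disj g⊆ (b ∷ ξ) ξ⊆ = by-cases (meets? (⋃ g) b)
  where
  ih = filter-∩ disj g⊆ ξ (ξ⊆ ∘ there)
  by-cases : Dec (Meets (⋃ g) b) → filter nonempty? (map (⋃ g ∩_) (b ∷ ξ)) ≡ filter (meets? (⋃ g)) (b ∷ ξ)
  by-cases (yes meets) = trans (filter-accept nonempty? meets) (trans
    (cong₂ _∷_ (∩-absorbs (∈-⋃⁺ (⋃-meets⇒⊆ disj g⊆ (ξ⊆ (here refl)) meets))) ih)
    (sym (filter-accept (meets? (⋃ g)) meets)))
  by-cases (no misses) = trans (filter-reject nonempty? misses) (trans ih (sym (filter-reject (meets? (⋃ g)) misses)))

∧SC-rows : {bs : SetComp n} → AllPairs Disjoint bs → (gs : List (SetComp n)) → (∀ {c} → c ∈ concat gs → c ∈ bs) →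
  {ξ : SetComp n} → (∀ {b} → b ∈ ξ → b ∈ bs) → map ⋃ gs ∧SC ξ ≡ concat (rows gs ξ)
∧SC-rows disj []       gs⊆ ξ⊆ = refl
∧SC-rows disj (g ∷ gs) gs⊆ {ξ} ξ⊆ = trans (filter-++ nonempty? (map (⋃ g ∩_) ξ) _)
  (cong₂ _++_ (filter-∩ {g = g} disj (gs⊆ ∘ ∈-++⁺ˡ) ξ ξ⊆) (∧SC-rows disj gs (gs⊆ ∘ ∈-++⁺ʳ g) ξ⊆))

-- The number of blocks of ψ∧χ

positive : ℕ → ℕ
positive zero    = 0
positive (suc _) = 1

support-∷ : ∀ a as → support (a ∷ as) ≡ positive a ℕ.+ support as
support-∷ zero    as = refl
support-∷ (suc a) as = refl

sum-map-+ : (f g : A → ℕ) (xs : List A) → sum (map (λ x → f x ℕ.+ g x) xs) ≡ sum (map f xs) ℕ.+ sum (map g xs)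
sum-map-+ f g []       = refl
sum-map-+ f g (x ∷ xs) = trans (cong (f x ℕ.+ g x ℕ.+_) (sum-map-+ f g xs)) (ℕ-interchange (f x) (g x) _ _)

count-meets : (g χ : SetComp n) →
  length (filter nonempty? (map (⋃ g ∩_) χ)) ≡ sum (map (λ c → positive (length (filter (meets? c) g))) χ)
count-meets g []      = refl
count-meets g (c ∷ χ) = by-cases (meets? (⋃ g) c)
  where
  hits = filter (meets? c) g
  some : Meets (⋃ g) c → positive (length hits) ≡ 1
  some (x , x∈) with x∈⋃ , x∈c ← x∈p∩q⁻ (⋃ g) c x∈ with b , b∈ , x∈b ← ∈-⋃⁻ g x∈⋃
    with hits | ∈-filter⁺ (meets? c) b∈ (x , x∈p∩q⁺ (x∈c , x∈b))
  ... | _ ∷ _ | _ = refl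
  none : ¬ Meets (⋃ g) c → positive (length hits) ≡ 0
  none misses = cong (positive ∘ length) (filter-none (meets? c) {g} (All.tabulate λ { {b} b∈ (x , x∈) →
    let x∈c , x∈b = x∈p∩q⁻ c b x∈ in misses (x , x∈p∩q⁺ (∈-⋃⁺ {bs = g} b∈ x∈b , x∈c)) }))
  by-cases : Dec (Meets (⋃ g) c) →
    length (filter nonempty? (map (⋃ g ∩_) (c ∷ χ))) ≡ sum (map (λ c → positive (length (filter (meets? c) g))) (c ∷ χ))
  by-cases (yes meets) = trans (cong length (filter-accept nonempty? meets)) (cong₂ ℕ._+_ (sym (some meets)) (count-meets g χ))
  by-cases (no misses) = trans (cong length (filter-reject nonempty? misses)) (cong₂ ℕ._+_ (sym (none misses)) (count-meets g χ))

-- Double counting of the pairs of a block of ψ and a block of χ that meet: by blocks of ψ on the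
-- left, by blocks of χ on the right.
length-∧SC : (gs : List (SetComp n)) (χ : SetComp n) → length (map ⋃ gs ∧SC χ) ≡ totalSupport (toTuples gs χ)
length-∧SC gs χ = trans (by-groups gs) (cong sum (map-∘ χ))
  where
  open ≡-Reasoning
  by-groups : ∀ gs → length (map ⋃ gs ∧SC χ) ≡ sum (map (λ c → support (lengths (map (filter (meets? c)) gs))) χ)
  by-groups []       = sym (sum-zeros χ)
    where
    sum-zeros : ∀ χ → sum (map (λ (_ : Subset _) → 0) χ) ≡ 0
    sum-zeros []      = refl
    sum-zeros (_ ∷ χ) = sum-zeros χ
  by-groups (g ∷ gs) = begin
    length (filter nonempty? (map (⋃ g ∩_) χ ++ _))                     ≡⟨ cong length (filter-++ nonempty? (map (⋃ g ∩_) χ) _) ⟩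
    length (filter nonempty? (map (⋃ g ∩_) χ) ++ (map ⋃ gs ∧SC χ))      ≡⟨ length-++ (filter nonempty? (map (⋃ g ∩_) χ)) ⟩
    length (filter nonempty? (map (⋃ g ∩_) χ)) ℕ.+ length (map ⋃ gs ∧SC χ) ≡⟨ cong₂ ℕ._+_ (count-meets g χ) (by-groups gs) ⟩
    sum (map (λ c → positive (length (filter (meets? c) g))) χ) ℕ.+ sum (map (λ c → support (lengths (map (filter (meets? c)) gs))) χ)
      ≡⟨ sum-map-+ _ _ χ ⟨
    sum (map (λ c → positive (length (filter (meets? c) g)) ℕ.+ support (lengths (map (filter (meets? c)) gs))) χ)
      ≡⟨ cong sum (map-cong (λ c → sym (support-∷ (length (filter (meets? c) g)) _)) χ) ⟩
    sum (map (λ c → support (lengths (map (filter (meets? c)) (g ∷ gs)))) χ) ∎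

-- The members of D as sequences of odd tuples

odd-⋃-tuple : {ps : List (SetComp n)} → AllPairs Disjoint (concat ps) → IsOddSC (concat ps) →
  odd ∣ ⋃ (concat ps) ∣ ≡ odd (sum (lengths ps))
odd-⋃-tuple {ps = ps} disj os = trans (odd-⋃ disj os) (cong odd (length-concat ps))

odd⇒concat≢[] : {ps : List (List A)} → OddTuple ps → concat ps ≢ []
odd⇒concat≢[] {ps = ps} o eq =
  ℕ.n≮0 (subst (0 <_) (trans (sym (length-concat ps)) (cong length eq)) (odd⇒positive _ o))

tuples-odd : (pss : List (List (SetComp n))) → AllPairs Disjoint (concat (map concat pss)) → IsOddSC (concat (map concat pss)) →
  All OddTuple pss → IsOddSC (fromTuples pss)
tuples-odd []         _    _  []        = []
tuples-odd (ps ∷ pss) disj os (o ∷ odds) with disj-ps , disj-pss , _ ← AllPairs-++⁻ (concat ps) disj =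
  odd⁻ {∣ ⋃ (concat ps) ∣} (trans (odd-⋃-tuple {ps = ps} disj-ps (All.++⁻ˡ (concat ps) os)) (odd⁺ {sum (lengths ps)} o))
  ∷ tuples-odd pss disj-pss (All.++⁻ʳ (concat ps) os) odds

odd-tuples : (pss : List (List (SetComp n))) → AllPairs Disjoint (concat (map concat pss)) → IsOddSC (concat (map concat pss)) →
  IsOddSC (fromTuples pss) → All OddTuple pss
odd-tuples []         _    _  []        = []
odd-tuples (ps ∷ pss) disj os (o ∷ odds) with disj-ps , disj-pss , _ ← AllPairs-++⁻ (concat ps) disj =
  odd⁻ {sum (lengths ps)} (trans (sym (odd-⋃-tuple {ps = ps} disj-ps (All.++⁻ˡ (concat ps) os))) (odd⁺ {∣ ⋃ (concat ps) ∣} o))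
  ∷ odd-tuples pss disj-pss (All.++⁻ʳ (concat ps) os) odds

fromTuples-disjoint : (pss : List (List (SetComp n))) → AllPairs Disjoint (concat (map concat pss)) → AllPairs Disjoint (fromTuples pss)
fromTuples-disjoint []         _    = []
fromTuples-disjoint (ps ∷ pss) disj with _ , disj-pss , cross ← AllPairs-++⁻ (concat ps) disj =
  All.map⁺ (All.tabulate λ {ps′} ps′∈ (x , x∈) →
    let x∈⋃ , x∈⋃′    = x∈p∩q⁻ (⋃ (concat ps)) (⋃ (concat ps′)) x∈
        b , b∈ , x∈b  = ∈-⋃⁻ (concat ps) x∈⋃
        c , c∈ , x∈c  = ∈-⋃⁻ (concat ps′) x∈⋃′
    in All.lookup (All.lookup cross b∈) (∈-concat⁺′ c∈ (∈-map⁺ concat ps′∈)) (x , x∈p∩q⁺ (x∈b , x∈c)))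
  ∷ fromTuples-disjoint pss disj-pss

⋃-nonempty : {bs : SetComp n} → All Nonempty bs → bs ≢ [] → Nonempty (⋃ bs)
⋃-nonempty []            ne = contradiction refl ne
⋃-nonempty {bs = b ∷ bs} ((x , x∈) ∷ _) _ = x , ∈-⋃⁺ {bs = b ∷ bs} (here refl) x∈

fromTuples-nonempty : (pss : List (List (SetComp n))) → All Nonempty (concat (map concat pss)) → All OddTuple pss →
  All Nonempty (fromTuples pss)
fromTuples-nonempty []         _  []       = []
fromTuples-nonempty (ps ∷ pss) ne (o ∷ os) =
  ⋃-nonempty (All.++⁻ˡ (concat ps) ne) (odd⇒concat≢[] {ps = ps} o) ∷ fromTuples-nonempty pss (All.++⁻ʳ (concat ps) ne) os

∈-rearrange⁻ : (φ : SetComp n) (τ : Permutation′ (length φ)) {b : Subset n} → b ∈ rearrange φ τ → b ∈ φ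
∈-rearrange⁻ φ τ b∈ with i , refl ← ∈-tabulate⁻ b∈ = ∈-lookup (τ ⟨$⟩ʳ i)

module _ {gs : List (SetComp n)} (φ-SC : IsSetComp (concat gs)) (φ-odd : IsOddSC (concat gs)) where

  private
    φ ψ : SetComp n
    φ = concat gs
    ψ = map ⋃ gs

    ne : All Nonempty φ
    ne = proj₁ φ-SC

    disj : AllPairs Disjoint φ
    disj = proj₁ (proj₂ φ-SC)

  fromTuples-InD : ∀ {pss} → Columns gs pss → All OddTuple pss → InD φ ψ (fromTuples pss)
  fromTuples-InD {pss} cols odds =
    (fromTuples-nonempty pss (↭.All-resp-↭ φ↭ξ ne) odds , fromTuples-disjoint pss disj-ξ , covers) ,
    tuples-odd pss disj-ξ (↭.All-resp-↭ φ↭ξ φ-odd) odds ,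
    ξ , inC , map concat pss , (All.map⁺ (All.map (λ {ps} → odd⇒concat≢[] {ps = ps}) odds) , refl) , sym (map-∘ pss)
    where
    ξ : SetComp n
    ξ = concat (map concat pss)
    φ↭ξ : φ ↭ ξ
    φ↭ξ = Columns-↭ cols
    disj-ξ : AllPairs Disjoint ξ
    disj-ξ = AllDisjoint-↭ φ↭ξ disj
    covers : (x : Fin n) → Any (x ∈ₛ_) (fromTuples pss)
    covers x with b , b∈ , x∈b ← find (proj₂ (proj₂ φ-SC) x)
             with _ , b∈′ , ps∈ ← ∈-concat⁻′ (map concat pss) (↭.∈-resp-↭ φ↭ξ b∈)
             with ps , ps∈′ , refl ← ∈-map⁻ concat ps∈ =
      lose (∈-map⁺ (⋃ ∘ concat) ps∈′) (∈-⋃⁺ b∈′ x∈b)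
    inC : InC φ ψ ξ
    inC with τ , eq ← ↭⇒rearrange φ ξ (↭-sym φ↭ξ) = τ , eq ,
      trans (∧SC-rows disj gs (λ c∈ → c∈) (↭.∈-resp-↭ (↭-sym φ↭ξ)))
            (cong concat (rows-Columns disj ne (⊑-refl gs) cols))

  module _ {ξ : SetComp n} (ξ⊆φ : ∀ {b} → b ∈ ξ → b ∈ φ) where

    rows-⊑ : ∀ gs′ → (∀ {c} → c ∈ concat gs′ → c ∈ φ) → rows gs′ ξ ⊑ gs′
    rows-⊑ []        gs′⊆ = []
    rows-⊑ (g ∷ gs′) gs′⊆ = All.tabulate (λ b∈ → let b∈ξ , meets = ∈-filter⁻ (meets? (⋃ g)) {xs = ξ} b∈ in
        ⋃-meets⇒⊆ disj (gs′⊆ ∘ ∈-++⁺ˡ) (ξ⊆φ b∈ξ) meets)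
      ∷ rows-⊑ gs′ (gs′⊆ ∘ ∈-++⁺ʳ g)

    -- The equation ψ∧ξ = φ compares only concatenations. Since `rows gs` recovers the words from
    -- their concatenation, the words agree one by one.
    rows-≡ : ψ ∧SC ξ ≡ φ → rows gs ξ ≡ gs
    rows-≡ ψ∧ξ≡φ = begin
      rows gs ξ                       ≡⟨ rows-concat disj ne (rows-⊑ gs (λ c∈ → c∈)) ⟨
      rows gs (concat (rows gs ξ))    ≡⟨ cong (rows gs) (trans (sym (∧SC-rows disj gs (λ c∈ → c∈) ξ⊆φ)) ψ∧ξ≡φ) ⟩
      rows gs φ                       ≡⟨ rows-concat disj ne (⊑-refl gs) ⟩
      gs                              ∎
      where open ≡-Reasoning

  ⋃-rows : {h : SetComp n} → (∀ {b} → b ∈ h → b ∈ φ) → ⋃ (concat (rows gs h)) ≡ ⋃ h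
  ⋃-rows {h} h⊆φ = ⊆-antisym below above
    where
    below : ⋃ (concat (rows gs h)) ⊆ₛ ⋃ h
    below x∈ with b , b∈ , x∈b ← ∈-⋃⁻ (concat (rows gs h)) x∈
             with _ , b∈r , r∈ ← ∈-concat⁻′ (rows gs h) b∈
             with g , _ , refl ← ∈-map⁻ (λ g → filter (meets? (⋃ g)) h) r∈ =
      ∈-⋃⁺ (proj₁ (∈-filter⁻ (meets? (⋃ g)) {xs = h} b∈r)) x∈b
    above : ⋃ h ⊆ₛ ⋃ (concat (rows gs h))
    above x∈ with b , b∈ , x∈b ← ∈-⋃⁻ h x∈ with g , b∈g , g∈ ← ∈-concat⁻′ gs (h⊆φ b∈) =
      ∈-⋃⁺ (∈-concat⁺′ (∈-filter⁺ (meets? (⋃ g)) b∈ (⋃-meets (_ , x∈b) b∈g))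
                        (∈-map⁺ (λ g → filter (meets? (⋃ g)) h) g∈)) x∈b

  -- The blocks of ξ that are merged into one block of χ, sorted by the blocks of ψ, form its tuple.
  -- Sorting respects concatenation and turns all of ξ into `gs`, so these tuples are successive
  -- cuts of `gs`.
  InD-fromTuples : ∀ {χ} → InD φ ψ χ → ∃ λ pss → Columns gs pss × All OddTuple pss × χ ≡ fromTuples pss
  InD-fromTuples {χ} (_ , χ-odd , ξ , (τ , ξ≡ , ψ∧ξ≡φ) , hs , (_ , refl) , refl) =
    map (rows gs) hs , cols , odd-tuples _ (AllDisjoint-↭ (Columns-↭ cols) disj) (↭.All-resp-↭ (Columns-↭ cols) φ-odd)
      (subst IsOddSC χ≡ χ-odd) , χ≡
    where
    ξ⊆φ : ∀ {b} → b ∈ concat hs → b ∈ φ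
    ξ⊆φ b∈ = ∈-rearrange⁻ φ τ (subst (_ ∈_) ξ≡ b∈)
    cols : Columns gs (map (rows gs) hs)
    cols = subst (λ ss → Columns ss (map (rows gs) hs)) (rows-≡ ξ⊆φ ψ∧ξ≡φ) (rows-splits gs hs)
    χ≡ : map ⋃ hs ≡ fromTuples (map (rows gs) hs)
    χ≡ = trans (map-cong-local (All.tabulate λ h∈ → sym (⋃-rows (λ b∈ → ξ⊆φ (∈-concat⁺′ b∈ h∈))))) (map-∘ hs)

-- Evaluation of the sum over D

support-lengths : {gs : List (List A)} → All (_≢ []) gs → support (lengths gs) ≡ length gs
support-lengths                 []        = refl
support-lengths {gs = [] ∷ _}      (ne ∷ _)  = contradiction refl ne
support-lengths {gs = (_ ∷ _) ∷ _} (_ ∷ nes) = cong suc (support-lengths nes)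

theorem11p5 : (n : ℕ) → 1 ≤ n → (φ ψ : SetComp n)
    → IsSetComp φ → IsOddSC φ → IsSetComp ψ → ψ ≤SC φ
    → (D : List (SetComp n)) → Unique D → ((χ : SetComp n) → (χ ∈ D) ⇔ InD φ ψ χ)
    → sumℤ (map (λ χ → (+ (2 ^ (length (ψ ∧SC χ) ∸ length χ))) * μ (length χ)) D)
    ≡ + (2 ^ (length ψ ∸ 1))
theorem11p5 n _ φ ψ φ-SC φ-odd _ (gs , (gs≢[] , refl) , refl) D D-unique D⇔ = begin
  ∑ D term                                                          ≡⟨ ∑-set term D-unique enumerated-unique to from ⟩
  ∑ (map fromTuples tuples) term                                    ≡⟨ ∑-map fromTuples tuples ⟩
  ∑ tuples (term ∘ fromTuples)                                      ≡⟨ ∑-cong tuples term-fromTuples ⟩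
  ∑ tuples (λ pss → columnsWeight pss * μ (length pss))             ≡⟨ ∑-oddColumns bound μ gs ⟩
  compose bound μ (lengths gs)                                      ≡⟨ compose-μ bound (lengths gs) ℕ.≤-refl ⟩
  Q (lengths gs)                                                    ≡⟨ cong (λ k → + (2 ^ (k ∸ 1))) (trans (support-lengths gs≢[]) (sym (length-map ⋃ gs))) ⟩
  + (2 ^ (length (map ⋃ gs) ∸ 1))                                   ∎
  where
  open ≡-Reasoning
  -- Both the completeness of `oddColumns` and `compose-μ` ask for a bound strictly above the number
  -- of blocks of φ.
  bound = suc (sum (lengths gs))
  tuples = oddColumns bound gs
  term : SetComp n → ℤ
  term χ = + (2 ^ (length (map ⋃ gs ∧SC χ) ∸ length χ)) * μ (length χ)

  columns : ∀ {pss} → pss ∈ tuples → Columns gs pss × All OddTuple pss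
  columns = ∈-oddColumns⁻ bound gs

  left-inverse : ∀ {pss} → pss ∈ tuples → toTuples gs (fromTuples pss) ≡ pss
  left-inverse pss∈ = toTuples-fromTuples (proj₁ (proj₂ φ-SC)) (proj₁ φ-SC) (proj₁ (columns pss∈))

  enumerated-unique : Unique (map fromTuples tuples)
  enumerated-unique = map-unique
    (λ pss∈ qss∈ eq → trans (sym (left-inverse pss∈)) (trans (cong (toTuples gs) eq) (left-inverse qss∈)))
    (oddColumns-unique bound gs)

  to : ∀ {χ} → χ ∈ D → χ ∈ map fromTuples tuples
  to {χ} χ∈ with pss , cols , odds , refl ← InD-fromTuples {gs = gs} φ-SC φ-odd (Equivalence.to (D⇔ χ) χ∈) =
    ∈-map⁺ fromTuples (∈-oddColumns⁺ bound ℕ.≤-refl cols odds)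

  from : ∀ {χ} → χ ∈ map fromTuples tuples → χ ∈ D
  from {χ} χ∈ with pss , pss∈ , refl ← ∈-map⁻ fromTuples χ∈ =
    Equivalence.from (D⇔ χ) (fromTuples-InD {gs = gs} φ-SC φ-odd (proj₁ (columns pss∈)) (proj₂ (columns pss∈)))

  term-fromTuples : ∀ {pss} → pss ∈ tuples → term (fromTuples pss) ≡ columnsWeight pss * μ (length pss)
  term-fromTuples {pss} pss∈ rewrite length-map (⋃ ∘ concat) pss = cong (λ w → w * μ (length pss)) (begin
    + (2 ^ (length (map ⋃ gs ∧SC fromTuples pss) ∸ length pss))
      ≡⟨ cong (λ k → + (2 ^ (k ∸ length pss))) (trans (length-∧SC gs (fromTuples pss)) (cong totalSupport (left-inverse pss∈))) ⟩
    + (2 ^ (totalSupport pss ∸ length pss))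
      ≡⟨ proj₂ (columnsWeight-2^ (proj₂ (columns pss∈))) ⟨
    columnsWeight pss ∎)
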